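{- One has $f(3,5)\le146$, $f(3,6)\le255$, and $f(3,7)\le474$.
   Context: $f(w,k)$ denotes the maximum size of a finite family of distinct $w$-element sets (on an arbitrary finite ground set) containing no $k$-sunflower. A $k$-sunflower is a collection of $k$ distinct sets $A_1,\dots,A_k$ for which there is a set $C$ (the core, possibly empty) with $A_i\cap A_j=C$ for all $i\ne j$. -}

module Defs where

open import Data.Nat using (ℕ; _≤_)
open import Data.Nat.Properties using (≤-antisym)
open import Data.Fin using (Fin)
open import Data.Fin.Subset using (Subset; ∣_∣; _∩_)
open import Data.List using (List; length)
open import Data.List.Membership.Propositional using (_∈_)
open import Data.List.Relation.Unary.All using (All)
open import Data.List.Relation.Unary.Unique.Propositional using (Unique)
open import Data.Product using (∃; _×_; _,_)
open import Function.Definitions using (Injective)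
open import Relation.Binary.PropositionalEquality using (_≡_; _≢_; refl)
open import Relation.Nullary using (¬_)

-- Finite ground sets are represented by Fin n, with n arbitrary.

record IsSunflower {n k : ℕ} (A : Fin k → Subset n) : Set where
  field
    distinct : Injective _≡_ _≡_ A
    core     : Subset n
    meets    : ∀ i j → i ≢ j → A i ∩ A j ≡ core

ContainsSunflower : ∀ {n} → ℕ → List (Subset n) → Set
ContainsSunflower {n} k F =
  ∃ λ (A : Fin k → Subset n) → (∀ i → A i ∈ F) × IsSunflower A

-- A family of sets is a duplicate-free list, so its size is its length.
record IsSunflowerFree {n : ℕ} (w k : ℕ) (F : List (Subset n)) : Set where
  field
    unique  : Unique F
    uniform : All (λ A → ∣ A ∣ ≡ w) F
    free    : ¬ ContainsSunflower k F

-- The graph of f: IsMaxSize w k m says f(w,k) = m.  A function ℕ → ℕ → ℕ would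
-- need a proof that the maximum exists for all w and k (for k = 0 it does not:
-- the empty collection is a 0-sunflower, so no family is free of it).  A bound
-- f(w,k) ≤ N reads ∃ λ m → IsMaxSize w k m × m ≤ N, which includes existence.
record IsMaxSize (w k m : ℕ) : Set where
  field
    attained : ∃ λ n → ∃ λ (F : List (Subset n)) →
                 IsSunflowerFree w k F × length F ≡ m
    bound    : ∀ {n} (F : List (Subset n)) →
                 IsSunflowerFree w k F → length F ≤ m

IsMaxSize-unique : ∀ {w k m m′} → IsMaxSize w k m → IsMaxSize w k m′ → m ≡ m′
IsMaxSize-unique p q = ≤-antisym (below p q) (below q p)
  where
  open IsMaxSize
  below : ∀ {w k m m′} → IsMaxSize w k m → IsMaxSize w k m′ → m ≤ m′
  below p q with attained p
  ... | _ , F , free , refl = bound q F free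

{-# OPTIONS --safe #-}
module Submission where

-- Put s = k − 1 and regard a family without a k-sunflower as a 3-graph: two vertices lie in at most s
-- triples, a vertex link is a graph with maximum degree and matching number at most s, and there are at
-- most s disjoint triples.  By Gallai's lemma such a graph splits, after removal of the vertices that
-- all its maximum matchings cover, into factor-critical pieces, so it has at most d = 20, 28, 42 edges
-- for s = 4, 5, 6.
--
-- Take a maximum matching of triples.  A triple of it is rich if some vertex x of it, called strong,
-- has more than t link edges outside the matching; then the other two vertices are weak, because the
-- triple can be moved onto x and such an edge, which frees them.  The other triples are poor.  By these
-- moves no triple consists of at most two weak vertices and outside vertices, and the link edges of the
-- three vertices of a poor triple to outside or weak vertices (not both weak) cross-intersect, so there
-- are at most t + 2rs of them, where r is the number of rich triples.  If a triple gives half of itself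
-- to each of its poor vertices, a whole to each strong one, and triples with one poor vertex and two
-- weak ones are paid for by the pair of weak vertices, the family has at most s(3d + t)/2 members.  The
-- choice t = 13, 18, 32 gives 146, 255, 474.
--
-- Deleting an uncovered point of the ground set keeps a family sunflower-free, so the maximum is
-- found by a finite search.

open import Defs
open import Data.Bool using (Bool; true; false; not; _∧_; if_then_else_)
import Data.Bool as Bool
open import Data.Empty using (⊥; ⊥-elim)
open import Data.Fin using (Fin; zero; suc; toℕ)
import Data.Fin as Fin
import Data.Fin.Properties as Fin
open import Data.Fin.Patterns using (0F; 1F; 2F; 3F)
open import Data.Fin.Permutation using (permutation)
open import Data.Fin.Subset using (Subset; _∈_; _⊆_; _∩_; _∪_; ⁅_⁆; ∣_∣) renaming (⊥ to ∅)
import Data.Fin.Subset.Properties as Subset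
open import Data.List using (List; []; _∷_; length; foldl; map)
import Data.List.Properties as List
import Data.List.Membership.DecPropositional as DecMembership
open import Data.List.Membership.Propositional using () renaming (_∈_ to _∈ᴸ_)
open import Data.List.Membership.Propositional.Properties using (∈-map⁺)
open import Data.List.Relation.Unary.All as All using (All; []; _∷_)
import Data.List.Relation.Unary.All.Properties as All
import Data.List.Relation.Unary.AllPairs as AllPairs
import Data.List.Relation.Unary.AllPairs.Properties as AllPairs
open import Data.List.Relation.Unary.Unique.Propositional using (Unique)
import Data.List.Relation.Unary.Unique.DecPropositional as DecUnique
open import Data.Nat
open import Data.Nat.Induction using (<-rec; <-wellFounded; Acc; acc)
open import Data.Nat.Properties
open import Data.Nat.Tactic.RingSolver using (solve-∀)
open import Data.Product using (∃; ∃₂; _×_; _,_; proj₁; proj₂)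
open import Data.Sum as Sum using (_⊎_; inj₁; inj₂)
open import Data.Unit using (tt)
import Data.Vec as Vec
import Data.Vec.Properties as Vec
open import Function using (_∘_; Injective)
open import Relation.Binary.Definitions using (tri<; tri≈; tri>)
open import Relation.Binary.PropositionalEquality
open import Relation.Nullary
import Relation.Nullary.Decidable as Dec
open import Relation.Nullary.Decidable
  using (decidable-stable; ¬¬-excluded-middle; dec-true; dec-false; from-yes)
open import Relation.Nullary.Negation using (contradiction)
open import Algebra.Properties.Semiring.Sum +-*-semiring
  using (sum; sum-syntax; sum-cong-≗; ∑-distrib-+; ∑-comm; *-distribˡ-sum; *-distribʳ-sum; sum-permute)

-- Finite sums

⟦_⟧ : Bool → ℕ
⟦ true ⟧ = 1
⟦ false ⟧ = 0

⟦⟧≤1 : ∀ b → ⟦ b ⟧ ≤ 1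
⟦⟧≤1 true = ≤-refl
⟦⟧≤1 false = z≤n

⟦∧⟧≤ : ∀ a b → ⟦ a ∧ b ⟧ ≤ ⟦ a ⟧
⟦∧⟧≤ true b = ⟦⟧≤1 b
⟦∧⟧≤ false b = z≤n

⟦⟧*≤ : ∀ b m → ⟦ b ⟧ * m ≤ m
⟦⟧*≤ true m = ≤-reflexive (+-identityʳ m)
⟦⟧*≤ false m = z≤n

0<⟦⟧⇒true : ∀ {b} → 0 < ⟦ b ⟧ → b ≡ true
0<⟦⟧⇒true {true} _ = refl

∑-mono : ∀ {n} {f g : Fin n → ℕ} → (∀ i → f i ≤ g i) → sum f ≤ sum g
∑-mono {zero} p = z≤n
∑-mono {suc n} p = +-mono-≤ (p zero) (∑-mono (p ∘ suc))

∑-const : ∀ n c → ∑[ i < n ] c ≡ n * c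
∑-const zero c = refl
∑-const (suc n) c = cong (c +_) (∑-const n c)

∑-zero : ∀ {n} {f : Fin n → ℕ} → (∀ i → f i ≡ 0) → sum f ≡ 0
∑-zero {n} p = trans (sum-cong-≗ p) (trans (∑-const n 0) (*-zeroʳ n))

∑-upper : ∀ {n} (f : Fin n → ℕ) i → f i ≤ sum f
∑-upper f zero = m≤m+n _ _
∑-upper f (suc i) = ≤-trans (∑-upper (f ∘ suc) i) (m≤n+m _ _)

∑-<⇒∃ : ∀ {n} {f g : Fin n → ℕ} → sum f < sum g → ∃ λ i → f i < g i
∑-<⇒∃ {suc n} {f} {g} p with f zero <? g zero
... | yes q = zero , q
... | no ¬q with ∑-<⇒∃ {f = f ∘ suc} {g ∘ suc}
                   (≰⇒> λ r → <⇒≱ p (+-mono-≤ (≮⇒≥ ¬q) r))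
...   | i , q = suc i , q

∑∑-<⇒∃ : ∀ {m n} {f g : Fin m → Fin n → ℕ} →
         ∑[ i < m ] ∑[ j < n ] f i j < ∑[ i < m ] ∑[ j < n ] g i j → ∃₂ λ i j → f i j < g i j
∑∑-<⇒∃ p with ∑-<⇒∃ p
... | i , q with ∑-<⇒∃ q
...   | j , r = i , j , r

δ : ∀ {n} → Fin n → Fin n → ℕ
δ a v = ⟦ does (a Fin.≟ v) ⟧

δ-refl : ∀ {n} (a : Fin n) → δ a a ≡ 1
δ-refl a rewrite dec-true (a Fin.≟ a) refl = refl

δ-≢ : ∀ {n} {a v : Fin n} → a ≢ v → δ a v ≡ 0
δ-≢ {a = a} {v} p rewrite dec-false (a Fin.≟ v) p = refl

δ-≡ : ∀ {n} {a v : Fin n} → a ≡ v → δ a v ≡ 1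
δ-≡ {a = a} refl = δ-refl a

∑-δ : ∀ {n} (a : Fin n) (f : Fin n → ℕ) → ∑[ v < n ] (δ a v * f v) ≡ f a
∑-δ {suc n} zero f =
  trans (cong₂ _+_ (+-identityʳ (f zero)) (∑-zero {n} λ _ → refl)) (+-identityʳ (f zero))
∑-δ {suc n} (suc a) f = trans (sum-cong-≗ (λ v → cong (_* f (suc v)) (δ-suc v))) (∑-δ a (f ∘ suc))
  where
  δ-suc : ∀ v → δ (suc a) (suc v) ≡ δ a v
  δ-suc v with a Fin.≟ v
  ... | yes refl = refl
  ... | no _ = refl

-- Turns a count of at least `k` into `k` distinct indices, the form in which the petals of a
-- sunflower are supplied.
∑-true⇒injection : ∀ {n} k (b : Fin n → Bool) → k ≤ ∑[ i < n ] ⟦ b i ⟧ →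
                   ∃ λ (ζ : Fin k → Fin n) → Injective _≡_ _≡_ ζ × ∀ j → b (ζ j) ≡ true
∑-true⇒injection zero b p = (λ ()) , (λ { {()} }) , λ ()
∑-true⇒injection {zero} (suc k) b ()
∑-true⇒injection {suc n} (suc k) b p with b zero in eq
... | false with ∑-true⇒injection (suc k) (b ∘ suc) p
...   | ζ , inj , t = suc ∘ ζ , (λ e → inj (Fin.suc-injective e)) , t
∑-true⇒injection {suc n} (suc k) b (s≤s p) | true with ∑-true⇒injection k (b ∘ suc) p
... | ζ , inj , t = ζ′ , inj′ , t′
  where
  ζ′ : Fin (suc k) → Fin (suc n)
  ζ′ zero = zero
  ζ′ (suc j) = suc (ζ j)
  inj′ : Injective _≡_ _≡_ ζ′
  inj′ {zero} {zero} _ = refl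
  inj′ {suc i} {suc j} e = cong suc (inj (Fin.suc-injective e))
  t′ : ∀ j → b (ζ′ j) ≡ true
  t′ zero = eq
  t′ (suc j) = t j

-- Excluded middle for finitely many propositions at once, under a double negation. This suffices
-- where the goal is a negation or a decidable inequality.
¬¬-decidable : ∀ {n} (P : Fin n → Set) → ¬ ¬ (∀ i → Dec (P i))
¬¬-decidable {zero} P k = k λ ()
¬¬-decidable {suc n} P k = ¬¬-excluded-middle λ d → ¬¬-decidable (P ∘ suc) λ ds →
  k λ { zero → d ; (suc i) → ds i }

⟦_≺_⟧ : ∀ {n} → Fin n → Fin n → ℕ
⟦ v ≺ w ⟧ = ⟦ does (v Fin.<? w) ⟧

⟦≺⟧-yes : ∀ {n} {v w : Fin n} → v Fin.< w → ⟦ v ≺ w ⟧ ≡ 1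
⟦≺⟧-yes {v = v} {w} p rewrite dec-true (v Fin.<? w) p = refl

⟦≺⟧-no : ∀ {n} {v w : Fin n} → ¬ v Fin.< w → ⟦ v ≺ w ⟧ ≡ 0
⟦≺⟧-no {v = v} {w} p rewrite dec-false (v Fin.<? w) p = refl

-- The diagonal vanishes, and the pairs with `v` above `w` mirror those with `v` below `w`.
∑∑-symmetric : ∀ {n} (F : Fin n → Fin n → ℕ) → (∀ v → F v v ≡ 0) → (∀ v w → F v w ≡ F w v) →
               ∑[ v < n ] ∑[ w < n ] F v w ≡ 2 * ∑[ v < n ] ∑[ w < n ] (⟦ v ≺ w ⟧ * F v w)
∑∑-symmetric {n} F irr sym-F = begin
  ∑[ v < n ] ∑[ w < n ] F v w
    ≡⟨ sum-cong-≗ (λ v → trans (sum-cong-≗ (split v)) (∑-distrib-+ {n} _ _)) ⟩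
  ∑[ v < n ] (∑[ w < n ] (⟦ v ≺ w ⟧ * F v w) + ∑[ w < n ] (⟦ w ≺ v ⟧ * F w v))
    ≡⟨ ∑-distrib-+ {n} _ _ ⟩
  S + ∑[ v < n ] ∑[ w < n ] (⟦ w ≺ v ⟧ * F w v)
    ≡⟨ cong (S +_) (∑-comm {n} {n} _) ⟩
  S + S
    ≡⟨ cong (S +_) (+-identityʳ S) ⟨
  2 * S ∎
  where
  open ≡-Reasoning
  S = ∑[ v < n ] ∑[ w < n ] (⟦ v ≺ w ⟧ * F v w)
  split : ∀ v w → F v w ≡ ⟦ v ≺ w ⟧ * F v w + ⟦ w ≺ v ⟧ * F w v
  split v w with Fin.<-cmp v w
  ... | tri< a _ c rewrite ⟦≺⟧-yes a | ⟦≺⟧-no c = sym (trans (+-identityʳ _) (+-identityʳ _))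
  ... | tri> a _ c rewrite ⟦≺⟧-no a | ⟦≺⟧-yes c = trans (sym-F v w) (sym (+-identityʳ _))
  ... | tri≈ a refl c rewrite ⟦≺⟧-no a = irr v

-- Matchings in graphs

record Graph (n : ℕ) : Set where
  field
    adj       : Fin n → Fin n → Bool
    adj-irr   : ∀ v → adj v v ≡ false
    adj-sym   : ∀ v w → adj v w ≡ adj w v

  deg : Fin n → ℕ
  deg v = ∑[ w < n ] ⟦ adj v w ⟧

  -- Ordered pairs, hence twice the number of edges.
  size : ℕ
  size = ∑[ v < n ] deg v

  adj⇒≢ : ∀ {v w} → adj v w ≡ true → v ≢ w
  adj⇒≢ {v} e refl with trans (sym e) (adj-irr v)
  ... | ()

open Graph

-- A matching, as the involution that exchanges the ends of its edges.
record Mate {n : ℕ} (G : Graph n) : Set where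
  field
    mate       : Fin n → Fin n
    involutive : ∀ v → mate (mate v) ≡ v
    matched    : ∀ v → mate v ≢ v → adj G v (mate v) ≡ true

  edges : ℕ
  edges = ∑[ v < n ] ⟦ v ≺ mate v ⟧

  edgesIn : (Fin n → Bool) → ℕ
  edgesIn C = ∑[ v < n ] (⟦ C v ⟧ * ⟦ v ≺ mate v ⟧)

  edges-split : ∀ C → edges ≡ edgesIn C + edgesIn (not ∘ C)
  edges-split C = trans (sum-cong-≗ λ v → split (C v) _) (∑-distrib-+ {n} _ _)
    where
    split : ∀ b x → x ≡ ⟦ b ⟧ * x + ⟦ not b ⟧ * x
    split true x = sym (trans (+-identityʳ _) (+-identityʳ x))
    split false x = sym (+-identityʳ x)

open Mate

empty-mate : ∀ {n} (G : Graph n) → Mate G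
empty-mate G .mate v = v
empty-mate G .involutive v = refl
empty-mate G .matched v p = ⊥-elim (p refl)

module Exchange {n} {G : Graph n} (C : Fin n → Bool) (N M : Mate G)
  (closedN : ∀ v → C (mate N v) ≡ C v) (closedM : ∀ v → C (mate M v) ≡ C v) where

  mix : Fin n → Fin n
  mix v = if C v then mate N v else mate M v

  mix-in : ∀ {v} → C v ≡ true → mix v ≡ mate N v
  mix-in p rewrite p = refl

  mix-out : ∀ {v} → C v ≡ false → mix v ≡ mate M v
  mix-out p rewrite p = refl

  -- As `C` is closed under both involutions, every edge lies within `C` or within its complement,
  -- so `N` on `C` and `M` off `C` fit together.
  exchange : Mate G
  exchange .mate = mix
  exchange .involutive v with C v in eq
  ... | true = trans (mix-in (trans (closedN v) eq)) (involutive N v)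
  ... | false = trans (mix-out (trans (closedM v) eq)) (involutive M v)
  exchange .matched v p with C v
  ... | true = matched N v p
  ... | false = matched M v p

  edges-exchange : edges exchange ≡ edgesIn N C + edgesIn M (not ∘ C)
  edges-exchange = trans (edges-split exchange C) (cong₂ _+_ (sum-cong-≗ inside) (sum-cong-≗ outside))
    where
    inside : ∀ v → ⟦ C v ⟧ * ⟦ v ≺ mix v ⟧ ≡ ⟦ C v ⟧ * ⟦ v ≺ mate N v ⟧
    inside v with C v
    ... | true = refl
    ... | false = refl
    outside : ∀ v → ⟦ not (C v) ⟧ * ⟦ v ≺ mix v ⟧ ≡ ⟦ not (C v) ⟧ * ⟦ v ≺ mate M v ⟧
    outside v with C v
    ... | true = refl
    ... | false = refl

-- Edges are counted at their smaller ends, so the count rises at `a`, which was unmatched, and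
-- falls nowhere.
add-edge : ∀ {n} {G : Graph n} (M : Mate G) {a b} → a Fin.< b → adj G a b ≡ true →
           mate M a ≡ a → mate M b ≡ b → ∃ λ (M′ : Mate G) → edges M < edges M′
add-edge {n} {G} M {a} {b} a<b ab fa fb = M′ , bound
  where
  b≢a : b ≢ a
  b≢a refl = Fin.<-irrefl refl a<b
  f : Fin n → Fin n
  f x with x Fin.≟ a
  ... | yes _ = b
  ... | no _ with x Fin.≟ b
  ...   | yes _ = a
  ...   | no _ = mate M x
  f-a : f a ≡ b
  f-a with a Fin.≟ a
  ... | yes _ = refl
  ... | no p = ⊥-elim (p refl)
  f-b : f b ≡ a
  f-b with b Fin.≟ a
  ... | yes p = ⊥-elim (b≢a p)
  ... | no _ with b Fin.≟ b
  ...   | yes _ = refl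
  ...   | no p = ⊥-elim (p refl)
  f-other : ∀ {x} → x ≢ a → x ≢ b → f x ≡ mate M x
  f-other {x} p q with x Fin.≟ a
  ... | yes r = ⊥-elim (p r)
  ... | no _ with x Fin.≟ b
  ...   | yes r = ⊥-elim (q r)
  ...   | no _ = refl
  avoid : ∀ {x c} → mate M c ≡ c → x ≢ c → mate M x ≢ c
  avoid {x} fc p q = p (trans (sym (involutive M x)) (trans (cong (mate M) q) fc))
  M′ : Mate G
  M′ .mate = f
  M′ .involutive x with x Fin.≟ a
  ... | yes refl = f-b
  ... | no p with x Fin.≟ b
  ...   | yes refl = f-a
  ...   | no q = trans (f-other (avoid fa p) (avoid fb q)) (involutive M x)
  M′ .matched x p with x Fin.≟ a
  ... | yes refl = ab
  ... | no _ with x Fin.≟ b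
  ...   | yes refl = trans (adj-sym G b a) ab
  ...   | no _ = matched M x p
  pointwise : ∀ x → δ a x * 1 + ⟦ x ≺ mate M x ⟧ ≤ ⟦ x ≺ f x ⟧
  pointwise x with x Fin.≟ a
  ... | yes refl rewrite δ-refl a | fa | ⟦≺⟧-no {v = a} {a} (Fin.<-irrefl refl) | ⟦≺⟧-yes a<b = ≤-refl
  ... | no p rewrite δ-≢ {a = a} {x} (p ∘ sym) with x Fin.≟ b
  ...   | yes refl rewrite fb | ⟦≺⟧-no {v = b} {b} (Fin.<-irrefl refl) = z≤n
  ...   | no _ = ≤-refl
  bound : edges M < edges M′
  bound = begin
    1 + edges M                                          ≡⟨ cong (_+ edges M) (∑-δ a (λ _ → 1)) ⟨
    ∑[ x < n ] (δ a x * 1) + edges M                     ≡⟨ ∑-distrib-+ {n} _ _ ⟨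
    ∑[ x < n ] (δ a x * 1 + ⟦ x ≺ mate M x ⟧)            ≤⟨ ∑-mono pointwise ⟩
    edges M′                                             ∎
    where open ≤-Reasoning

∑-involution : ∀ {n} (μ : Fin n → Fin n) → (∀ v → μ (μ v) ≡ v) → (f : Fin n → ℕ) →
               ∑[ v < n ] f (μ v) ≡ sum f
∑-involution μ inv f = sym (sum-permute f (permutation μ μ inv inv))

module _ {n} {G : Graph n} (C : Fin n → Bool) (M : Mate G) (closed : ∀ v → C (mate M v) ≡ C v)
  (u : Fin n) (Cu : C u ≡ true) (missed : mate M u ≡ u)
  (only : ∀ v → C v ≡ true → mate M v ≡ v → v ≡ u) where

  -- Every vertex of `C` other than `u` is the smaller or the larger end of exactly one edge, and
  -- the involution carries larger ends to smaller ones.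
  odd-class : ∑[ v < n ] ⟦ C v ⟧ ≡ 1 + 2 * edgesIn M C
  odd-class = begin
    ∑[ v < n ] ⟦ C v ⟧
      ≡⟨ sum-cong-≗ pointwise ⟩
    ∑[ v < n ] (δ u v * 1 + (up v + up (mate M v)))
      ≡⟨ trans (∑-distrib-+ {n} _ _) (cong₂ _+_ (∑-δ u (λ _ → 1)) (∑-distrib-+ {n} up (up ∘ mate M))) ⟩
    1 + (edgesIn M C + ∑[ v < n ] up (mate M v))
      ≡⟨ cong (λ z → 1 + (edgesIn M C + z)) (trans (∑-involution (mate M) (involutive M) up) (sym (+-identityʳ _))) ⟩
    1 + 2 * edgesIn M C ∎
    where
    open ≡-Reasoning
    up : Fin n → ℕ
    up v = ⟦ C v ⟧ * ⟦ v ≺ mate M v ⟧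
    pointwise : ∀ v → ⟦ C v ⟧ ≡ δ u v * 1 + (up v + up (mate M v))
    pointwise v rewrite closed v | involutive M v with C v in eq
    ... | false rewrite δ-≢ {a = u} {v} (λ { refl → contradiction (trans (sym eq) Cu) λ () }) = refl
    ... | true with Fin.<-cmp v (mate M v)
    ...   | tri< a b c rewrite ⟦≺⟧-yes a | ⟦≺⟧-no c | δ-≢ {a = u} {v} (λ { refl → b (sym missed) }) = refl
    ...   | tri> a b c rewrite ⟦≺⟧-no a | ⟦≺⟧-yes c | δ-≢ {a = u} {v} (λ { refl → b (sym missed) }) = refl
    ...   | tri≈ a b c rewrite ⟦≺⟧-no a | ⟦≺⟧-no c | δ-≡ {a = u} {v} (sym (only v eq (sym b))) = refl

-- Deletion of vertices

∧-true : ∀ {a b} → a ∧ b ≡ true → a ≡ true × b ≡ true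
∧-true {true} {true} _ = refl , refl

-- The deleted vertices stay in `Fin n` as isolated ones, so a matching of the smaller graph is at
-- once a matching of `G`.
delete : ∀ {n} → Graph n → (Fin n → Bool) → Graph n
delete G C .adj v w = adj G v w ∧ (not (C v) ∧ not (C w))
delete G C .adj-irr v rewrite adj-irr G v = refl
delete G C .adj-sym v w rewrite adj-sym G v w with adj G w v | C v | C w
... | true  | true  | true  = refl
... | true  | true  | false = refl
... | true  | false | true  = refl
... | true  | false | false = refl
... | false | _     | _     = refl

module _ {n} {G : Graph n} {C : Fin n → Bool} where

  undelete : Mate (delete G C) → Mate G
  undelete M .mate = mate M
  undelete M .involutive = involutive M
  undelete M .matched v p = proj₁ (∧-true (matched M v p))

  undelete-missed : ∀ (M : Mate (delete G C)) {v} → C v ≡ true → mate M v ≡ v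
  undelete-missed M {v} Cv = decidable-stable (mate M v Fin.≟ v) λ p → absurd (matched M v p)
    where
    absurd : ¬ adj G v (mate M v) ∧ (not (C v) ∧ not (C (mate M v))) ≡ true
    absurd e with trans (sym (cong not Cv)) (proj₁ (∧-true (proj₂ (∧-true {adj G v (mate M v)} e))))
    ... | ()

  undelete-closed : ∀ (M : Mate (delete G C)) v → C (mate M v) ≡ C v
  undelete-closed M v with mate M v Fin.≟ v
  ... | yes p = cong C p
  ... | no p = trans (not-true (proj₂ both)) (sym (not-true (proj₁ both)))
    where
    both = ∧-true {not (C v)} (proj₂ (∧-true {adj G v (mate M v)} (matched M v p)))
    not-true : ∀ {b} → not b ≡ true → b ≡ false
    not-true {false} _ = refl

  deg-delete : ∀ v → deg (delete G C) v ≤ deg G v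
  deg-delete v = ∑-mono λ w → ⟦∧⟧≤ (adj G v w) _

does-cong : ∀ {A B : Set} (a? : Dec A) (b? : Dec B) → (A → B) → (B → A) → does a? ≡ does b?
does-cong (yes a) b? f g = sym (dec-true b? (f a))
does-cong (no ¬a) b? f g = sym (dec-false b? (¬a ∘ g))

-- Gallai's lemma

module MaximumMatchings {n} (G : Graph n) (m : ℕ) (bound : ∀ (M : Mate G) → edges M ≤ m) where

  -- The bound `m` need not be attained. If it is not, no vertex is missed by a maximum matching,
  -- and the deletion step of the induction on `m` applies.
  Maximum : Mate G → Set
  Maximum M = m ≤ edges M

  CoMissed : Fin n → Fin n → Set
  CoMissed u v = ∃ λ (M : Mate G) → Maximum M × mate M u ≡ u × mate M v ≡ v

  CoMissed-sym : ∀ {u v} → CoMissed u v → CoMissed v u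
  CoMissed-sym (M , max , Mu , Mv) = M , max , Mv , Mu

  -- Otherwise the edge could be added to a maximum matching.
  adj⇒¬CoMissed : ∀ {u v} → adj G u v ≡ true → ¬ CoMissed u v
  adj⇒¬CoMissed {u} {v} e (M , max , Mu , Mv) with Fin.<-cmp u v
  ... | tri≈ _ u≡v _ = adj⇒≢ G e u≡v
  ... | tri< u<v _ _ with add-edge M u<v e Mu Mv
  ...   | M′ , lt = <⇒≱ (<-≤-trans lt (bound M′)) max
  adj⇒¬CoMissed {u} {v} e (M , max , Mu , Mv) | tri> _ _ v<u
    with add-edge M v<u (trans (adj-sym G v u) e) Mv Mu
  ... | M′ , lt = <⇒≱ (<-≤-trans lt (bound M′)) max

  -- M and N may be exchanged on any set closed under both; the two results have as many edges as M
  -- and N together, so both are again maximum.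
  closed-set-meets : ∀ (M N : Mate G) → Maximum M → Maximum N → (P : Fin n → Set) →
                     (∀ {v} → P v → P (mate M v)) → (∀ {v} → P v → P (mate N v)) →
                     ∀ {w u} → mate N w ≡ w → P w → mate M u ≡ u → ¬ CoMissed w u → ¬ ¬ P u
  closed-set-meets M N maxM maxN P closedM closedN {w} {u} Nw Pw Mu ¬wu ¬Pu =
    ¬¬-decidable P contra
    where
    contra : ¬ (∀ v → Dec (P v))
    contra P? = ¬wu (MN.exchange , max , trans (MN.mix-in {w} (dec-true (P? w) Pw)) Nw ,
                     trans (MN.mix-out {u} (dec-false (P? u) ¬Pu)) Mu)
      where
      C : Fin n → Bool
      C v = does (P? v)
      invariant : (L : Mate G) → (∀ {v} → P v → P (mate L v)) → ∀ v → C (mate L v) ≡ C v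
      invariant L cl v = does-cong (P? (mate L v)) (P? v) (λ p → subst P (involutive L v) (cl p)) cl
      module MN = Exchange C N M (invariant N closedN) (invariant M closedM)
      module NM = Exchange C M N (invariant M closedM) (invariant N closedN)
      regroup : ∀ a b c d → (a + b) + (c + d) ≡ (c + b) + (a + d)
      regroup = solve-∀
      max : m ≤ edges MN.exchange
      max = +-cancelʳ-≤ m m _ (begin
        m + m                                    ≤⟨ +-mono-≤ maxN maxM ⟩
        edges N + edges M                        ≡⟨ cong₂ _+_ (edges-split N C) (edges-split M C) ⟩
        _                                        ≡⟨ regroup (edgesIn N C) _ (edgesIn M C) _ ⟩
        _                                        ≡⟨ cong₂ _+_ NM.edges-exchange MN.edges-exchange ⟨
        edges NM.exchange + edges MN.exchange    ≤⟨ +-monoˡ-≤ _ (bound NM.exchange) ⟩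
        m + edges MN.exchange                    ≡⟨ +-comm m _ ⟩
        edges MN.exchange + m                    ∎)
        where open ≤-Reasoning

  module Path (M N : Mate G) (maxM : Maximum M) (maxN : Maximum N) (w : Fin n) (Nw : mate N w ≡ w) where

    -- A walk along `M` and `N` alternately, from a vertex that `N` misses. `path` lists every
    -- second vertex; their `M`-partners lie in between.
    path : ℕ → Fin n
    path zero = w
    path (suc j) = mate N (mate M (path j))

    OnPath : (ℕ → Set) → Fin n → Set
    OnPath J v = ∃ λ j → J j × (path j ≡ v ⊎ mate M (path j) ≡ v)

    closedM : ∀ {J v} → OnPath J v → OnPath J (mate M v)
    closedM (j , Jj , inj₁ refl) = j , Jj , inj₂ refl
    closedM (j , Jj , inj₂ refl) = j , Jj , inj₁ (sym (involutive M _))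

    -- At index zero because `N` fixes `w`, later because the `N`-partner of `path (suc j)` is
    -- `mate M (path j)`.
    back : ∀ {J} → (∀ {j} → J (suc j) → J j) → ∀ j → J j → OnPath J (mate N (path j))
    back down zero J0 = zero , J0 , inj₁ (sym Nw)
    back down (suc j) Jj = j , down Jj , inj₂ (sym (involutive N _))

    fixed : ∀ {J v} → mate M v ≡ v → OnPath J v → ∃ λ j → J j × path j ≡ v
    fixed Mv (j , Jj , inj₁ e) = j , Jj , e
    fixed Mv (j , Jj , inj₂ refl) = j , Jj , trans (sym (involutive M _)) Mv

    -- Otherwise exchanging `M` and `N` on the whole path would give a maximum matching that misses
    -- both `w` and `u`.
    reaches : ∀ {u} → mate M u ≡ u → ¬ CoMissed w u → ¬ ¬ ∃ λ j → path j ≡ u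
    -- `Fin n` serves as the always true condition on indices, with `w` as its inhabitant.
    reaches Mu ¬wu k = closed-set-meets M N maxM maxN (OnPath (λ _ → Fin n)) closedM closedN
      Nw (0 , w , inj₁ refl) Mu ¬wu λ p → let j , _ , e = fixed Mu p in k (j , e)
      where
      closedN : ∀ {v} → OnPath (λ _ → Fin n) v → OnPath (λ _ → Fin n) (mate N v)
      closedN (j , Jj , inj₁ refl) = back (λ x → x) j Jj
      closedN (j , Jj , inj₂ refl) = suc j , Jj , inj₁ refl

    -- The path turns back at a vertex u missed by M, so the part before it is closed, and the other
    -- missed vertex v is met earlier; then the roles of u and v are exchanged.
    descent : ∀ j → Acc _<_ j → ∀ {u v} → u ≢ v → mate M u ≡ u → mate M v ≡ v →
              ¬ CoMissed w u → ¬ CoMissed w v → path j ≢ u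
    descent j (acc rec) {u} {v} u≢v Mu Mv ¬wu ¬wv refl =
      closed-set-meets M N maxM maxN (OnPath (_≤ j)) closedM closedN Nw (0 , z≤n , inj₁ refl) Mv ¬wv
        λ p → let i , i≤j , e = fixed Mv p in
          descent i (rec (≤∧≢⇒< i≤j λ i≡j → u≢v (trans (cong path (sym i≡j)) e))) (u≢v ∘ sym) Mv Mu ¬wv ¬wu e
      where
      closedN : ∀ {v} → OnPath (_≤ j) v → OnPath (_≤ j) (mate N v)
      closedN (i , i≤j , inj₁ refl) = back (≤-trans (n≤1+n _)) i i≤j
      closedN (i , i≤j , inj₂ refl) with i ≟ j
      ... | yes refl = subst (λ z → OnPath (_≤ j) (mate N z)) (sym Mu) (back (≤-trans (n≤1+n _)) j i≤j)
      ... | no i≢j = suc i , ≤∧≢⇒< i≤j i≢j , inj₁ refl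

  module Missable (missable : ∀ v → ¬ ¬ CoMissed v v) where

    -- Gallai's lemma. If a maximum matching `M` misses `u` and `v` while `N` misses `w`, the
    -- alternating path from `w` would have to end both at `u` and at `v`.
    ¬CoMissed-trans : ∀ {u v w} → ¬ CoMissed u w → ¬ CoMissed w v → u ≢ v → ¬ CoMissed u v
    ¬CoMissed-trans {w = w} ¬uw ¬wv u≢v (M , maxM , Mu , Mv) = missable w λ (N , maxN , Nw , _) →
      let open Path M N maxM maxN w Nw
          ¬wu = ¬uw ∘ CoMissed-sym
      in reaches Mu ¬wu λ (j , e) → descent j (<-wellFounded j) u≢v Mu Mv ¬wu ¬wv e

    module ClassOf (u : Fin n) (M : Mate G) (maxM : Maximum M) (Mu : mate M u ≡ u)
             (R? : ∀ v → Dec (CoMissed u v)) where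

      -- `M` misses `u`, so `u` is missed together with itself and has to be put into its own class
      -- separately.
      class : Fin n → Bool
      class v = does (v Fin.≟ u) Bool.∨ not (does (R? v))

      Class : Fin n → Set
      Class v = v ≡ u ⊎ ¬ CoMissed u v

      class⇒Class : ∀ {v} → class v ≡ true → Class v
      class⇒Class {v} e with v Fin.≟ u | R? v
      ... | yes p | _ = inj₁ p
      ... | no _  | no ¬r = inj₂ ¬r

      Class⇒class : ∀ {v} → Class v → class v ≡ true
      Class⇒class {v} c with v Fin.≟ u | R? v | c
      ... | yes _ | _ | _ = refl
      ... | no _ | no _ | _ = refl
      ... | no p | yes _ | inj₁ q = ⊥-elim (p q)
      ... | no _ | yes r | inj₂ ¬r = ⊥-elim (¬r r)

      -- Adjacent vertices are never missed together, so by transitivity a class is a union of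
      -- components.
      class-adj : ∀ {v w} → adj G v w ≡ true → class v ≡ true → class w ≡ true
      class-adj {v} {w} e c with class⇒Class {v} c
      ... | inj₁ refl = Class⇒class {w} (inj₂ (adj⇒¬CoMissed e))
      ... | inj₂ ¬uv with w Fin.≟ u
      ...   | yes w≡u = refl
      ...   | no w≢u rewrite dec-false (R? w) (¬CoMissed-trans ¬uv (adj⇒¬CoMissed e) (w≢u ∘ sym)) = refl

      class-adj-≡ : ∀ {v w} → adj G v w ≡ true → class v ≡ class w
      class-adj-≡ {v} {w} e with class v in p | class w in q
      ... | true  | true  = refl
      ... | false | false = refl
      ... | true  | false = trans (sym (class-adj e p)) q
      ... | false | true  = trans (sym p) (class-adj (trans (adj-sym G w v) e) q)

      class-mate : ∀ v → class (mate M v) ≡ class v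
      class-mate v with mate M v Fin.≟ v
      ... | yes p = cong class p
      ... | no p = sym (class-adj-≡ (matched M v p))

      class-root : class u ≡ true
      class-root = Class⇒class (inj₁ refl)

      class-missed : ∀ v → class v ≡ true → mate M v ≡ v → v ≡ u
      class-missed v c Mv with class⇒Class {v} c
      ... | inj₁ p = p
      ... | inj₂ ¬uv = ⊥-elim (¬uv (M , maxM , Mu , Mv))

      h : ℕ
      h = edgesIn M class

      ∣class∣ : ∑[ v < n ] ⟦ class v ⟧ ≡ 1 + 2 * h
      ∣class∣ = odd-class class M class-mate u class-root Mu class-missed

      -- `v` and its neighbours all lie in the class, which has `1 + 2 * h` vertices.
      deg-class : ∀ v → class v ≡ true → deg G v ≤ 2 * h
      deg-class v c = s≤s⁻¹ (begin
        1 + deg G v                                   ≡⟨ cong (_+ deg G v) (∑-δ v (λ _ → 1)) ⟨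
        ∑[ w < n ] (δ v w * 1) + deg G v              ≡⟨ ∑-distrib-+ {n} _ _ ⟨
        ∑[ w < n ] (δ v w * 1 + ⟦ adj G v w ⟧)        ≤⟨ ∑-mono pointwise ⟩
        ∑[ w < n ] ⟦ class w ⟧                        ≡⟨ ∣class∣ ⟩
        1 + 2 * h                                     ∎)
        where
        open ≤-Reasoning
        pointwise : ∀ w → δ v w * 1 + ⟦ adj G v w ⟧ ≤ ⟦ class w ⟧
        pointwise w with v Fin.≟ w
        ... | yes refl rewrite adj-irr G v | c = ≤-refl
        ... | no _ with adj G v w in e
        ...   | false = z≤n
        ...   | true rewrite class-adj {v} {w} e c = ≤-refl

      -- The `h` edges of `M` within the class can be added to `L`, so deleting the class lowers the
      -- matching bound by `h`.
      edges-outside : ∀ (L : Mate (delete G class)) → edges L + h ≤ m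
      edges-outside L = begin
        edges L + h                               ≡⟨ cong (_+ h) (edges-split L class) ⟩
        edgesIn L class + edgesIn L (not ∘ class) + h
          ≡⟨ cong (λ z → z + edgesIn L (not ∘ class) + h) (∑-zero inside) ⟩
        edgesIn L (not ∘ class) + h               ≡⟨ +-comm _ h ⟩
        h + edgesIn L (not ∘ class)               ≡⟨ edges-exchange ⟨
        edges exchange                            ≤⟨ bound exchange ⟩
        m                                         ∎
        where
        open ≤-Reasoning
        open Exchange class M (undelete {G = G} L) class-mate (undelete-closed {G = G} L)
        inside : ∀ v → ⟦ class v ⟧ * ⟦ v ≺ mate L v ⟧ ≡ 0
        inside v with class v in c
        ... | false = refl
        ... | true rewrite undelete-missed {G = G} L {v} c | ⟦≺⟧-no {v = v} {v} (Fin.<-irrefl refl) = refl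

      size-class : ℕ
      size-class = ∑[ v < n ] (⟦ class v ⟧ * deg G v)

      size-delete-class : size G ≤ size-class + size (delete G class)
      size-delete-class = begin
        size G                                                         ≤⟨ ∑-mono pointwise ⟩
        ∑[ v < n ] (⟦ class v ⟧ * deg G v + deg (delete G class) v)    ≡⟨ ∑-distrib-+ {n} _ _ ⟩
        size-class + size (delete G class)                             ∎
        where
        open ≤-Reasoning
        pointwise : ∀ v → deg G v ≤ ⟦ class v ⟧ * deg G v + deg (delete G class) v
        pointwise v with class v in c
        ... | true = ≤-trans (m≤m+n _ _) (m≤m+n _ _)
        ... | false = ∑-mono entry
          where
          entry : ∀ w → ⟦ adj G v w ⟧ ≤ ⟦ adj G v w ∧ not (class w) ⟧
          entry w with adj G v w in e
          ... | false = z≤n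
          ... | true rewrite trans (sym (class-adj-≡ {v} {w} e)) c = ≤-refl

      -- Lets the class be measured by its number `e` of edges, so that integrality can be used in
      -- the ratio.
      size-class-even : ∃ λ e → size-class ≡ 2 * e
      size-class-even = ∑[ v < n ] ∑[ w < n ] (⟦ v ≺ w ⟧ * (⟦ class v ⟧ * ⟦ adj G v w ⟧)) ,
        trans (sum-cong-≗ {n} λ v → *-distribˡ-sum {n} ⟦ class v ⟧ _)
        (∑∑-symmetric (λ v w → ⟦ class v ⟧ * ⟦ adj G v w ⟧) irr symm)
        where
        irr : ∀ v → ⟦ class v ⟧ * ⟦ adj G v v ⟧ ≡ 0
        irr v rewrite adj-irr G v = *-zeroʳ ⟦ class v ⟧
        symm : ∀ v w → ⟦ class v ⟧ * ⟦ adj G v w ⟧ ≡ ⟦ class w ⟧ * ⟦ adj G w v ⟧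
        symm v w rewrite adj-sym G w v with adj G v w in e
        ... | true rewrite class-adj-≡ {v} {w} e = refl
        ... | false = trans (*-zeroʳ ⟦ class v ⟧) (sym (*-zeroʳ ⟦ class w ⟧))

      size-class-≤ : ∀ c → (∀ v → class v ≡ true → deg G v ≤ c) → size-class ≤ (1 + 2 * h) * c
      size-class-≤ c p = begin
        size-class                       ≤⟨ ∑-mono pointwise ⟩
        ∑[ v < n ] (⟦ class v ⟧ * c)     ≡⟨ *-distribʳ-sum {n} c _ ⟨
        ∑[ v < n ] ⟦ class v ⟧ * c       ≡⟨ cong (_* c) ∣class∣ ⟩
        (1 + 2 * h) * c                  ∎
        where
        open ≤-Reasoning
        pointwise : ∀ v → ⟦ class v ⟧ * deg G v ≤ ⟦ class v ⟧ * c
        pointwise v with class v in e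
        ... | true = +-monoˡ-≤ 0 (p v e)
        ... | false = z≤n

-- Number of edges in terms of degree and matching number

remove : ∀ {n} → Graph n → Fin n → Graph n
remove G v = delete G (λ w → does (v Fin.≟ w))

deg-remove : ∀ {n} (G : Graph n) v w → deg (remove G v) w ≤ deg G w
deg-remove G v = deg-delete {G = G} {λ w → does (v Fin.≟ w)}

-- An ordered pair that is lost has `v` as its first or as its second entry.
size-remove : ∀ {n} (G : Graph n) v {s} → deg G v ≤ s → size G ≤ 2 * s + size (remove G v)
size-remove {n} G v {s} deg≤s = begin
  size G
    ≤⟨ ∑-mono row ⟩
  ∑[ x < n ] (δ v x * deg G x + ⟦ adj G x v ⟧ + deg G′ x)
    ≡⟨ trans (∑-distrib-+ {n} _ _) (cong (_+ size G′) (∑-distrib-+ {n} _ _)) ⟩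
  ∑[ x < n ] (δ v x * deg G x) + ∑[ x < n ] ⟦ adj G x v ⟧ + size G′
    ≡⟨ cong (_+ size G′) (cong₂ _+_ (∑-δ v (deg G)) (sum-cong-≗ {n} λ x → cong ⟦_⟧ (adj-sym G x v))) ⟩
  deg G v + deg G v + size G′
    ≤⟨ +-monoˡ-≤ (size G′) (+-mono-≤ deg≤s (≤-trans deg≤s (m≤m+n s 0))) ⟩
  2 * s + size G′ ∎
  where
  open ≤-Reasoning
  G′ = remove G v
  entry : ∀ x y → ⟦ adj G x y ⟧ ≤ δ v x * ⟦ adj G x y ⟧ + δ v y * ⟦ adj G x y ⟧ + ⟦ adj G′ x y ⟧
  entry x y with adj G x y | v Fin.≟ x | v Fin.≟ y
  ... | false | _     | _     = z≤n
  ... | true  | yes _ | _     = s≤s z≤n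
  ... | true  | no _  | yes _ = s≤s z≤n
  ... | true  | no _  | no _  = s≤s z≤n
  row : ∀ x → deg G x ≤ δ v x * deg G x + ⟦ adj G x v ⟧ + deg G′ x
  row x = begin
    deg G x
      ≤⟨ ∑-mono (entry x) ⟩
    ∑[ y < n ] (δ v x * ⟦ adj G x y ⟧ + δ v y * ⟦ adj G x y ⟧ + ⟦ adj G′ x y ⟧)
      ≡⟨ trans (∑-distrib-+ {n} _ _) (cong (_+ deg G′ x) (∑-distrib-+ {n} _ _)) ⟩
    ∑[ y < n ] (δ v x * ⟦ adj G x y ⟧) + ∑[ y < n ] (δ v y * ⟦ adj G x y ⟧) + deg G′ x
      ≡⟨ cong (_+ deg G′ x) (cong₂ _+_ (sym (*-distribˡ-sum {n} (δ v x) _)) (∑-δ v (λ y → ⟦ adj G x y ⟧))) ⟩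
    δ v x * deg G x + ⟦ adj G x v ⟧ + deg G′ x ∎

adj-remove : ∀ {n} (G : Graph n) {v x y} → adj (remove G v) x y ≡ true →
             adj G x y ≡ true × x ≢ v × y ≢ v
adj-remove G {v} {x} {y} e with adj G x y | v Fin.≟ x | v Fin.≟ y
... | true | no p | no q = refl , p ∘ sym , q ∘ sym

-- Chvátal and Hanson's bound.  κ / 3 bounds the ratio of edges to matching edges in a factor-critical
-- graph of maximum degree s.
module _ (s κ : ℕ) (3s≤κ : 3 * s ≤ κ)
  (ratio : ∀ h e → 2 * e ≤ (1 + 2 * h) * s → 2 * e ≤ (1 + 2 * h) * (2 * h) → 3 * e ≤ κ * h) where

  SizeBound : ℕ → Set
  SizeBound m = ∀ {n} (G : Graph n) → (∀ v → deg G v ≤ s) → (∀ (M : Mate G) → edges M ≤ m) →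
                3 * size G ≤ 2 * (κ * m)

  -- For a vertex that every maximum matching covers. Removing it costs at most `s` edges, no more
  -- than a third of `κ`, and lowers the matching bound by one.
  delete-vertex : ∀ {m n} (G : Graph n) → (∀ v → deg G v ≤ s) → SizeBound m →
                  ∀ v → (∀ M → mate M v ≡ v → edges M ≤ m) → 3 * size G ≤ 2 * (κ * suc m)
  delete-vertex {m} G deg≤s ih v essential = begin
    3 * size G                                           ≤⟨ *-monoʳ-≤ 3 (size-remove G v (deg≤s v)) ⟩
    3 * (2 * s + size (remove G v))                      ≡⟨ expand s (size (remove G v)) ⟩
    2 * (3 * s) + 3 * size (remove G v)                  ≤⟨ +-mono-≤ (*-monoʳ-≤ 2 3s≤κ) smaller ⟩
    2 * κ + 2 * (κ * m)                                  ≡⟨ collect κ m ⟩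
    2 * (κ * suc m)                                      ∎
    where
    open ≤-Reasoning
    expand : ∀ a b → 3 * (2 * a + b) ≡ 2 * (3 * a) + 3 * b
    expand = solve-∀
    collect : ∀ a b → 2 * a + 2 * (a * b) ≡ 2 * (a * suc b)
    collect = solve-∀
    smaller : 3 * size (remove G v) ≤ 2 * (κ * m)
    smaller = ih (remove G v) (λ w → ≤-trans (deg-remove G v w) (deg≤s w))
      (λ M → essential (undelete {G = G} M) (undelete-missed {G = G} M (dec-true (v Fin.≟ v) refl)))

  -- Strong induction, assuming that the bound fails. Then every vertex is missed by some maximum
  -- matching, as it could be deleted otherwise. So the class of a vertex with an edge is a union of
  -- components with its own share `h` of the matching, and it is split off.
  size-bound : ∀ m → SizeBound m
  size-bound = <-rec SizeBound step
    where
    step : ∀ m → (∀ {m′} → m′ < m → SizeBound m′) → SizeBound m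
    step m ih {n} G deg≤s bound = decidable-stable (3 * size G ≤? 2 * (κ * m)) contra
      where
      open MaximumMatchings G m bound
      missable : ¬ 3 * size G ≤ 2 * (κ * m) → ∀ v → ¬ ¬ CoMissed v v
      missable ¬goal v ¬missed = below m ih ¬goal λ M Mv → ≰⇒> λ max → ¬missed (M , max , Mv , Mv)
        where
        below : ∀ m → (∀ {m′} → m′ < m → SizeBound m′) → ¬ 3 * size G ≤ 2 * (κ * m) →
                ¬ (∀ M → mate M v ≡ v → edges M < m)
        below zero _ _ f = contradiction (f (empty-mate G) refl) λ ()
        below (suc m) ih ¬goal f =
          ¬goal (delete-vertex G deg≤s (ih ≤-refl) v (λ M Mv → s≤s⁻¹ (f M Mv)))
      contra : ¬ ¬ 3 * size G ≤ 2 * (κ * m)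
      contra ¬goal with Fin.any? (λ u → 0 <? deg G u)
      ... | no ¬edge = ¬goal (subst (λ z → 3 * z ≤ 2 * (κ * m))
              (sym (∑-zero {n} {deg G} λ v → n≤0⇒n≡0 (≮⇒≥ λ p → ¬edge (v , p)))) z≤n)
      ... | yes (u , 0<deg) = missable ¬goal u λ (M , maxM , Mu , _) →
              ¬¬-decidable (CoMissed u) λ R? → ¬goal (bound-by-class M maxM Mu R?)
        where
        bound-by-class : (M : Mate G) → Maximum M → mate M u ≡ u → (∀ v → Dec (CoMissed u v)) →
                         3 * size G ≤ 2 * (κ * m)
        bound-by-class M maxM Mu R? = begin
          3 * size G                                ≤⟨ *-monoʳ-≤ 3 (size-delete-class) ⟩
          3 * (size-class + size G′) ≡⟨ cong (λ z → 3 * (z + size G′)) (proj₂ size-class-even) ⟩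
          3 * (2 * e + size G′)                     ≡⟨ expand e (size G′) ⟩
          2 * (3 * e) + 3 * size G′                 ≤⟨ +-mono-≤ (*-monoʳ-≤ 2 class-bound) rest ⟩
          2 * (κ * h) + 2 * (κ * (m ∸ h))         ≡⟨ collect κ h (m ∸ h) ⟩
          2 * (κ * (h + (m ∸ h)))                 ≡⟨ cong (λ z → 2 * (κ * z)) (m+[n∸m]≡n h≤m) ⟩
          2 * (κ * m)                               ∎
          where
          open ≤-Reasoning
          open Missable (missable ¬goal)
          open ClassOf u M maxM Mu R?
          G′ = delete G class
          e = proj₁ size-class-even
          expand : ∀ a b → 3 * (2 * a + b) ≡ 2 * (3 * a) + 3 * b
          expand = solve-∀
          collect : ∀ a b c → 2 * (a * b) + 2 * (a * c) ≡ 2 * (a * (b + c))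
          collect = solve-∀
          h≤m : h ≤ m
          h≤m = ≤-trans (m≤n+m h _) (edges-outside (empty-mate G′))
          -- `u` has a neighbour, so the class contains a matching edge, and the matching bound
          -- strictly decreases.
          0<h : 0 < h
          0<h = *-cancelˡ-< 2 0 h (<-≤-trans 0<deg
            (deg-class u (class-root)))
          class-bound : 3 * e ≤ κ * h
          -- Degrees in the class are at most `s` by hypothesis and at most `2 * h` by its order.
          class-bound = ratio h e
            (subst (_≤ (1 + 2 * h) * s) (proj₂ size-class-even) (size-class-≤ s (λ v _ → deg≤s v)))
            (subst (_≤ (1 + 2 * h) * (2 * h)) (proj₂ size-class-even)
              (size-class-≤ (2 * h) (deg-class)))
          rest : 3 * size G′ ≤ 2 * (κ * (m ∸ h))
          rest = ih (∸-monoʳ-< 0<h h≤m) G′ (λ w → ≤-trans (deg-delete {G = G} {class} w) (deg≤s w))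
            λ L → m+n≤o⇒m≤o∸n (edges L) (edges-outside L)

-- Cross-intersecting graphs

Disjoint : ∀ {n} → Fin n → Fin n → Fin n → Fin n → Set
Disjoint y z y′ z′ = (y ≢ y′ × y ≢ z′) × (z ≢ y′ × z ≢ z′)

Disjoint-sym : ∀ {n} {y z y′ z′ : Fin n} → Disjoint y z y′ z′ → Disjoint y′ z′ y z
Disjoint-sym ((a , b) , (c , d)) = (a ∘ sym , c ∘ sym) , (b ∘ sym , d ∘ sym)

CrossIntersecting : ∀ {n} → Graph n → Graph n → Set
CrossIntersecting F F′ = ∀ {y z y′ z′} → adj F y z ≡ true → adj F′ y′ z′ ≡ true → ¬ Disjoint y z y′ z′

CrossIntersecting-sym : ∀ {n} {F F′ : Graph n} → CrossIntersecting F F′ → CrossIntersecting F′ F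
CrossIntersecting-sym c e e′ d = c e′ e (Disjoint-sym d)

Avoids : ∀ {n} → Fin n → Fin n → Fin n → Set
Avoids y z p = y ≢ p × z ≢ p

Differs : ∀ {n} → Fin n → Fin n → Fin n × Fin n → Set
Differs y z (a , b) = ¬ (y ≡ a × z ≡ b) × ¬ (y ≡ b × z ≡ a)

module _ {n : ℕ} where

  -- Both orders are counted, so an entry of the list accounts for two ordered pairs, as an edge
  -- does in `size`.
  copies : List (Fin n × Fin n) → Fin n → Fin n → ℕ
  copies [] y z = 0
  copies ((a , b) ∷ qs) y z = (δ a y * δ b z + δ b y * δ a z) + copies qs y z

  copies-≡0 : ∀ qs {y z} → copies qs y z ≡ 0 → All (Differs y z) qs
  copies-≡0 [] _ = []
  copies-≡0 ((a , b) ∷ qs) {y} {z} e =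
    ((λ { (refl , refl) → one (m+n≡0⇒m≡0 _ (m+n≡0⇒m≡0 _ e)) }) ,
     (λ { (refl , refl) → one (m+n≡0⇒n≡0 (δ a y * δ b z) (m+n≡0⇒m≡0 _ e)) })) ∷
    copies-≡0 qs (m+n≡0⇒n≡0 (δ a y * δ b z + δ b y * δ a z) e)
    where
    one : δ y y * δ z z ≢ 0
    one rewrite δ-refl y | δ-refl z = λ ()

  ∑∑-copies : ∀ qs → ∑[ y < n ] ∑[ z < n ] copies qs y z ≡ length qs * 2
  ∑∑-copies [] = ∑-zero {n} λ _ → ∑-zero {n} λ _ → refl
  ∑∑-copies ((a , b) ∷ qs) = begin
    ∑[ y < n ] ∑[ z < n ] ((δ a y * δ b z + δ b y * δ a z) + copies qs y z)
      ≡⟨ sum-cong-≗ {n} (λ y → trans (∑-distrib-+ {n} _ _) (cong (_+ ∑[ z < n ] copies qs y z) (∑-distrib-+ {n} _ _))) ⟩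
    ∑[ y < n ] (∑[ z < n ] (δ a y * δ b z) + ∑[ z < n ] (δ b y * δ a z) + ∑[ z < n ] copies qs y z)
      ≡⟨ trans (∑-distrib-+ {n} _ _) (cong₂ _+_ (∑-distrib-+ {n} _ _) (∑∑-copies qs)) ⟩
    ∑[ y < n ] ∑[ z < n ] (δ a y * δ b z) + ∑[ y < n ] ∑[ z < n ] (δ b y * δ a z) + length qs * 2
      ≡⟨ cong (_+ length qs * 2) (cong₂ _+_ (one a b) (one b a)) ⟩
    2 + length qs * 2 ∎
    where
    open ≡-Reasoning
    one : ∀ a b → ∑[ y < n ] ∑[ z < n ] (δ a y * δ b z) ≡ 1
    one a b = trans (sum-cong-≗ {n} λ y → trans (sym (*-distribˡ-sum {n} (δ a y) (δ b)))
                (cong (δ a y *_) (trans (sum-cong-≗ {n} λ z → sym (*-identityʳ _)) (∑-δ b (λ _ → 1)))))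
              (∑-δ a (λ _ → 1))

  removeAll : Graph n → List (Fin n) → Graph n
  removeAll = foldl remove

  deg-removeAll : ∀ ps (F : Graph n) v → deg (removeAll F ps) v ≤ deg F v
  deg-removeAll [] F v = ≤-refl
  deg-removeAll (p ∷ ps) F v = ≤-trans (deg-removeAll ps (remove F p) v) (deg-remove F p v)

  size-removeAll : ∀ {s} ps (F : Graph n) → (∀ v → deg F v ≤ s) →
                   size F ≤ length ps * (2 * s) + size (removeAll F ps)
  size-removeAll [] F deg≤s = ≤-refl
  size-removeAll {s} (p ∷ ps) F deg≤s = begin
    size F                                ≤⟨ size-remove F p (deg≤s p) ⟩
    2 * s + size (remove F p)             ≤⟨ +-monoʳ-≤ (2 * s) (size-removeAll ps (remove F p)
                                               λ v → ≤-trans (deg-remove F p v) (deg≤s v)) ⟩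
    2 * s + (length ps * (2 * s) + size (removeAll F (p ∷ ps)))
                                          ≡⟨ +-assoc (2 * s) _ _ ⟨
    length (p ∷ ps) * (2 * s) + size (removeAll F (p ∷ ps)) ∎
    where open ≤-Reasoning

  adj-removeAll : ∀ ps (F : Graph n) {y z} → adj (removeAll F ps) y z ≡ true →
                  adj F y z ≡ true × All (Avoids y z) ps
  adj-removeAll [] F e = e , []
  adj-removeAll (p ∷ ps) F {y} {z} e =
    let e₁ , avoids = adj-removeAll ps (remove F p) e
        e₂ , y≢p , z≢p = adj-remove F {p} {y} {z} e₁
    in e₂ , (y≢p , z≢p) ∷ avoids

  opaque
    -- A vertex of `ps` accounts for at most `2 * s` ordered pairs and an edge of `qs` for two, so a
    -- larger graph has an edge besides.
    escape : ∀ {s} (F : Graph n) → (∀ v → deg F v ≤ s) → ∀ ps qs →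
             length ps * (2 * s) + length qs * 2 < size F →
             ∃₂ λ y z → adj F y z ≡ true × All (Avoids y z) ps × All (Differs y z) qs
    escape {s} F deg≤s ps qs lt
      with ∑∑-<⇒∃ {n} {n} (subst (_< size (removeAll F ps)) (sym (∑∑-copies qs))
             (+-cancelˡ-< (length ps * (2 * s)) _ _ (<-≤-trans lt (size-removeAll ps F deg≤s))))
    ... | y , z , lt′ =
      let e , avoids = adj-removeAll ps F (0<⟦⟧⇒true (m<n⇒0<n lt′))
      in y , z , e , avoids , copies-≡0 qs (n<1⇒n≡0 (<-≤-trans lt′ (⟦⟧≤1 (adj (removeAll F ps) y z))))

  -- The four listed pairs are the only ones that meet both `a b` and `c d`.
  misses-one : ∀ {a b c d y z : Fin n} → Disjoint a b c d →
               All (Differs y z) ((a , c) ∷ (a , d) ∷ (b , c) ∷ (b , d) ∷ []) →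
               Disjoint y z a b ⊎ Disjoint y z c d
  misses-one {a} {b} {c} {d} {y} {z} ((a≢c , a≢d) , (b≢c , b≢d))
    ((ac , ca) ∷ (ad , da) ∷ (bc , cb) ∷ (bd , db) ∷ [])
    with y Fin.≟ a | y Fin.≟ b | y Fin.≟ c | y Fin.≟ d | z Fin.≟ a | z Fin.≟ b
  ... | yes refl | _ | _ | _ | _ | _ = inj₂ ((a≢c , a≢d) , ((λ e → ac (refl , e)) , λ e → ad (refl , e)))
  ... | no _ | yes refl | _ | _ | _ | _ = inj₂ ((b≢c , b≢d) , ((λ e → bc (refl , e)) , λ e → bd (refl , e)))
  ... | no p | no q | yes refl | _ | _ | _ = inj₁ ((p , q) , ((λ e → ca (refl , e)) , λ e → cb (refl , e)))
  ... | no p | no q | no _ | yes refl | _ | _ = inj₁ ((p , q) , ((λ e → da (refl , e)) , λ e → db (refl , e)))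
  ... | no p | no q | no r | no t | yes refl | _ = inj₂ ((r , t) , (a≢c , a≢d))
  ... | no p | no q | no r | no t | no _ | yes refl = inj₂ ((r , t) , (b≢c , b≢d))
  ... | no p | no q | no _ | no _ | no u | no v = inj₁ ((p , q) , (u , v))

  -- An edge that is not a side of the triangle has at most one end in it, and so avoids the side
  -- opposite to that end.
  misses-side : ∀ {p q r y z : Fin n} → y ≢ z → p ≢ q → q ≢ r → p ≢ r →
                All (Differs y z) ((p , q) ∷ (q , r) ∷ (p , r) ∷ []) →
                Disjoint y z p q ⊎ Disjoint y z q r ⊎ Disjoint y z p r
  misses-side {p} {q} {r} {y} {z} y≢z p≢q q≢r p≢r ((pq , qp) ∷ (qr , rq) ∷ (pr , rp) ∷ [])
    with y Fin.≟ p | y Fin.≟ q | z Fin.≟ p | z Fin.≟ q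
  ... | yes refl | _ | _ | _ = inj₂ (inj₁ ((p≢q , p≢r) , ((λ e → pq (refl , e)) , λ e → pr (refl , e))))
  ... | no _ | yes refl | _ | _ = inj₂ (inj₂ ((p≢q ∘ sym , q≢r) , ((λ e → qp (refl , e)) , λ e → qr (refl , e))))
  ... | no a | no b | yes refl | _ = inj₂ (inj₁ ((b , (λ e → rp (e , refl))) , (p≢q , p≢r)))
  ... | no a | no b | no _ | yes refl = inj₂ (inj₂ ((a , (λ e → rq (e , refl))) , (p≢q ∘ sym , q≢r)))
  ... | no a | no b | no c | no d = inj₁ ((a , b) , (c , d))

  module _ {s : ℕ} (4≤s : 4 ≤ s) where

    -- An intersecting graph is a star or a triangle.
    disjoint-pair : ∀ (F : Graph n) → (∀ v → deg F v ≤ s) → 2 * s < size F →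
                    ∃₂ λ a b → ∃₂ λ c d → adj F a b ≡ true × adj F c d ≡ true × Disjoint a b c d
    disjoint-pair F deg≤s big with escape F deg≤s [] [] (m<n⇒0<n big)
    ... | p , q , pq , _ = through q-side p-side
      where
      Result = ∃₂ λ a b → ∃₂ λ c d → adj F a b ≡ true × adj F c d ≡ true × Disjoint a b c d
      big′ : 1 * (2 * s) + 0 < size F
      big′ = subst (_< size F) (sym (trans (+-identityʳ _) (+-identityʳ _))) big
      -- There are more than `s` edges, so one avoids `v`; it is disjoint from `w v` or a second
      -- edge at `w`.
      other : ∀ v w → adj F w v ≡ true → Result ⊎ ∃ λ r → adj F w r ≡ true × r ≢ v
      other v w wv with escape F deg≤s (v ∷ []) [] big′
      ... | y , z , e , (y≢v , z≢v) ∷ [] , [] with y Fin.≟ w | z Fin.≟ w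
      ...   | yes refl | _ = inj₂ (z , e , z≢v)
      ...   | no _ | yes refl = inj₂ (y , trans (adj-sym F z y) e , y≢v)
      ...   | no p | no q = inj₁ (y , z , w , v , e , wv , (p , y≢v) , (q , z≢v))
      q-side = other p q (trans (adj-sym F q p) pq)
      p-side = other q p pq
      through : Result ⊎ (∃ λ r → adj F q r ≡ true × r ≢ p) →
                Result ⊎ (∃ λ r → adj F p r ≡ true × r ≢ q) → Result
      through (inj₁ res) _ = res
      through (inj₂ _) (inj₁ res) = res
      through (inj₂ (r , qr , r≢p)) (inj₂ (r′ , pr′ , r′≢q)) with r Fin.≟ r′
      ... | no r≢r′ = q , r , p , r′ , qr , pr′ , (adj⇒≢ F pq ∘ sym , r′≢q ∘ sym) , (r≢p , r≢r′)
      -- Now `p q r` is a triangle, and there are more than three edges, so some edge is not a side.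
      ... | yes refl with escape F deg≤s [] ((p , q) ∷ (q , r) ∷ (p , r) ∷ [])
                           (≤-<-trans (≤-trans (m≤n+m 6 2) (*-monoʳ-≤ 2 4≤s)) big)
      ...   | y , z , e , [] , differs
        with misses-side (adj⇒≢ F e) (adj⇒≢ F pq) (adj⇒≢ F qr) (r≢p ∘ sym) differs
      ...     | inj₁ d = y , z , p , q , e , pq , d
      ...     | inj₂ (inj₁ d) = y , z , q , r , e , qr , d
      ...     | inj₂ (inj₂ d) = y , z , p , r , e , pr′ , d

    opaque
      -- `F` has more than `s` edges and hence two disjoint ones. Only four pairs meet both, and
      -- `F′` has more than four edges.
      disjoint-edges : ∀ (F F′ : Graph n) → (∀ v → deg F v ≤ s) → (∀ v → deg F′ v ≤ s) →
                       2 * s < size F → 8 < size F′ →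
                       ∃₂ λ a b → ∃₂ λ c d → adj F a b ≡ true × adj F′ c d ≡ true × Disjoint a b c d
      disjoint-edges F F′ deg≤s deg′≤s big big′ with disjoint-pair F deg≤s big
      ... | a , b , c , d , ab , cd , disj
        with escape F′ deg′≤s [] ((a , c) ∷ (a , d) ∷ (b , c) ∷ (b , d) ∷ []) big′
      ...   | y , z , e , [] , differs with misses-one disj differs
      ...     | inj₁ m = a , b , y , z , ab , e , Disjoint-sym m
      ...     | inj₂ m = c , d , y , z , cd , e , Disjoint-sym m

    cross-size-≤8 : ∀ {F F′ : Graph n} → (∀ v → deg F v ≤ s) → (∀ v → deg F′ v ≤ s) →
                    CrossIntersecting F F′ → 2 * s < size F → size F′ ≤ 8
    cross-size-≤8 {F} {F′} deg≤s deg′≤s cross big = ≮⇒≥ λ big′ →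
      let _ , _ , _ , _ , e , e′ , d = disjoint-edges F F′ deg≤s deg′≤s big big′ in cross e e′ d

    -- Every edge of `F` passes through `a` or `b`.
    cross-size-one : ∀ {F F′ : Graph n} → (∀ v → deg F v ≤ s) → CrossIntersecting F F′ →
                     ∀ {a b} → adj F′ a b ≡ true → size F ≤ 4 * s
    cross-size-one {F} deg≤s cross {a} {b} ab = ≮⇒≥ small
      where
      double : ∀ s → 4 * s ≡ 2 * (2 * s) + 0
      double = solve-∀
      small : ¬ 4 * s < size F
      small big with escape F deg≤s (a ∷ b ∷ []) [] (subst (_< size F) (double s) big)
      ... | y , z , e , (ya , za) ∷ (yb , zb) ∷ [] , [] = cross e ab ((ya , yb) , (za , zb))

    -- Every edge of `F` passes through `p` or is `a b`.
    cross-size-star : ∀ {F F′ : Graph n} → (∀ v → deg F v ≤ s) → CrossIntersecting F F′ →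
                      ∀ {p a b} → adj F′ p a ≡ true → adj F′ p b ≡ true → a ≢ b → size F ≤ 2 * s + 2
    cross-size-star {F} deg≤s cross {p} {a} {b} pa pb a≢b = ≮⇒≥ small
      where
      once : ∀ s → 2 * s + 2 ≡ 1 * (2 * s) + 1 * 2
      once = solve-∀
      impossible : ∀ {y z} → adj F y z ≡ true → y ≢ p → z ≢ p → ¬ (y ≡ a × z ≡ b) → ¬ ¬ (y ≡ b × z ≡ a)
      impossible {y} {z} e yp zp ab ba with y Fin.≟ a | y Fin.≟ b | z Fin.≟ a
      ... | yes refl | _ | _ = cross e pb ((yp , a≢b) , (zp , λ q → ab (refl , q)))
      ... | no ya | yes refl | _ = cross e pa ((yp , ya) , (zp , λ q → ba (refl , q)))
      ... | no ya | no yb | no za = cross e pa ((yp , ya) , (zp , za))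
      ... | no ya | no yb | yes refl = cross e pb ((yp , yb) , (zp , a≢b))
      small : ¬ 2 * s + 2 < size F
      small big with escape F deg≤s (p ∷ []) ((a , b) ∷ []) (subst (_< size F) (once s) big)
      ... | y , z , e , (yp , zp) ∷ [] , (ab , ba) ∷ [] = impossible e yp zp ab ba

    -- Two edges of `F′` with a common end form a star. If they are disjoint, all edges of `F` are
    -- among the four pairs that join them, and four is at most `s + 1`.
    cross-size-two : ∀ {F F′ : Graph n} → (∀ v → deg F v ≤ s) → (∀ v → deg F′ v ≤ s) →
                     CrossIntersecting F F′ → 2 < size F′ → size F ≤ 2 * s + 2
    cross-size-two {F} {F′} deg≤s deg′≤s cross big′ with escape F′ deg′≤s [] [] (m<n⇒0<n big′)
    ... | a , b , ab , _ with escape F′ deg′≤s [] ((a , b) ∷ []) big′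
    ...   | c , d , cd , [] , (ne , ne′) ∷ [] with a Fin.≟ c | a Fin.≟ d | b Fin.≟ c | b Fin.≟ d
    ... | yes refl | _ | _ | _ = cross-size-star {F} {F′} deg≤s cross ab cd λ { refl → ne (refl , refl) }
    ... | no _ | yes refl | _ | _ =
          cross-size-star {F} {F′} deg≤s cross ab (trans (adj-sym F′ d c) cd) λ { refl → ne′ (refl , refl) }
    ... | no _ | no _ | yes refl | _ =
          cross-size-star {F} {F′} deg≤s cross (trans (adj-sym F′ b a) ab) cd λ { refl → ne′ (refl , refl) }
    ... | no _ | no _ | no _ | yes refl =
          cross-size-star {F} {F′} deg≤s cross (trans (adj-sym F′ b a) ab) (trans (adj-sym F′ d c) cd)
            λ { refl → ne (refl , refl) }
    ... | no ac | no ad | no bc | no bd = ≮⇒≥ λ big →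
          let y , z , e , _ , differs = escape F deg≤s []
                ((a , c) ∷ (a , d) ∷ (b , c) ∷ (b , d) ∷ [])
                (≤-<-trans (≤-trans (*-monoʳ-≤ 2 4≤s) (m≤m+n _ 2)) big)
          in Sum.[ cross e ab , cross e cd ] (misses-one ((ac , ad) , (bc , bd)) differs)

    module _ {τ : ℕ} (3s≤τ : 3 * s ≤ τ) (s+9≤τ : s + 9 ≤ τ) (2s+2≤τ : 2 * s + 2 ≤ τ) where

      private
        two-bound : 2 * s + 2 + 16 ≤ 2 * τ
        two-bound = subst (_≤ 2 * τ) (double s) (*-monoʳ-≤ 2 s+9≤τ)
          where
          double : ∀ s → 2 * (s + 9) ≡ 2 * s + 2 + 16
          double = solve-∀

        one-bound : 4 * s + 4 ≤ 2 * τ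
        one-bound = subst (_≤ 2 * τ) (double s) (*-monoʳ-≤ 2 2s+2≤τ)
          where
          double : ∀ s → 2 * (2 * s + 2) ≡ 4 * s + 4
          double = solve-∀

      -- As `F` has more than `s` edges, the others have at most four each. If one of them has two,
      -- the total is at most `(s + 1) + 4 + 4` edges; if both have at most one and not both are
      -- empty, it is at most `2 * s + 1 + 1`; if both are empty, `F` stands alone.
      cross-sum-large : ∀ {F F′ F″ : Graph n} →
        (∀ v → deg F v ≤ s) → (∀ v → deg F′ v ≤ s) → (∀ v → deg F″ v ≤ s) →
        CrossIntersecting F F′ → CrossIntersecting F F″ → 2 * s < size F → size F ≤ 2 * τ →
        size F + (size F′ + size F″) ≤ 2 * τ
      cross-sum-large {F} {F′} {F″} deg≤s deg′≤s deg″≤s c′ c″ big F≤2τ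
        with 2 <? size F′ | 2 <? size F″ | 0 <? size F′ | 0 <? size F″
      ... | yes two | _ | _ | _ = ≤-trans (+-mono-≤ (cross-size-two {F} {F′} deg≤s deg′≤s c′ two)
              (+-mono-≤ (cross-size-≤8 {F} {F′} deg≤s deg′≤s c′ big)
                (cross-size-≤8 {F} {F″} deg≤s deg″≤s c″ big)))
            two-bound
      ... | no _ | yes two | _ | _ = ≤-trans (+-mono-≤ (cross-size-two {F} {F″} deg≤s deg″≤s c″ two)
              (+-mono-≤ (cross-size-≤8 {F} {F′} deg≤s deg′≤s c′ big)
                (cross-size-≤8 {F} {F″} deg≤s deg″≤s c″ big)))
            two-bound
      ... | no le′ | no le″ | yes one | _ with escape F′ deg′≤s [] [] one
      ...   | _ , _ , ab , _ = ≤-trans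
              (+-mono-≤ (cross-size-one {F} {F′} deg≤s c′ ab) (+-mono-≤ (≮⇒≥ le′) (≮⇒≥ le″)))
              one-bound
      cross-sum-large {F} {F′} {F″} deg≤s deg′≤s deg″≤s c′ c″ big F≤2τ
          | no le′ | no le″ | no _ | yes one with escape F″ deg″≤s [] [] one
      ...   | _ , _ , ab , _ = ≤-trans
              (+-mono-≤ (cross-size-one {F} {F″} deg≤s c″ ab) (+-mono-≤ (≮⇒≥ le′) (≮⇒≥ le″)))
              one-bound
      cross-sum-large {F} {F′} {F″} _ _ _ _ _ _ F≤2τ | no _ | no _ | no none′ | no none″
        rewrite n≤0⇒n≡0 (≮⇒≥ none′) | n≤0⇒n≡0 (≮⇒≥ none″) | +-identityʳ (size F) = F≤2τ

      -- Either none of the three has more than `s` edges, which `3s≤τ` covers, or one that has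
      -- takes the first place.
      cross-sum : ∀ {F F′ F″ : Graph n} →
        (∀ v → deg F v ≤ s) → (∀ v → deg F′ v ≤ s) → (∀ v → deg F″ v ≤ s) →
        CrossIntersecting F F′ → CrossIntersecting F F″ → CrossIntersecting F′ F″ →
        size F ≤ 2 * τ → size F′ ≤ 2 * τ → size F″ ≤ 2 * τ →
        size F + (size F′ + size F″) ≤ 2 * τ
      cross-sum {F} {F′} {F″} d d′ d″ c′ c″ c‴ b b′ b″
        with 2 * s <? size F | 2 * s <? size F′ | 2 * s <? size F″
      ... | yes big | _ | _ = cross-sum-large {F} {F′} {F″} d d′ d″ c′ c″ big b
      ... | no _ | yes big | _ = subst (_≤ 2 * τ) (arith (size F′) (size F) (size F″))
              (cross-sum-large {F′} {F} {F″} d′ d d″ (CrossIntersecting-sym {F = F} {F′} c′) c‴ big b′)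
        where
        arith : ∀ a b c → a + (b + c) ≡ b + (a + c)
        arith = solve-∀
      ... | no _ | no _ | yes big = subst (_≤ 2 * τ) (arith (size F″) (size F) (size F′))
              (cross-sum-large {F″} {F} {F′} d″ d d′ (CrossIntersecting-sym {F = F} {F″} c″)
                (CrossIntersecting-sym {F = F′} {F″} c‴) big b″)
        where
        arith : ∀ a b c → a + (b + c) ≡ b + (c + a)
        arith = solve-∀
      ... | no le | no le′ | no le″ = ≤-trans (+-mono-≤ (≮⇒≥ le) (+-mono-≤ (≮⇒≥ le′) (≮⇒≥ le″)))
              (subst (_≤ 2 * τ) (arith s) (*-monoʳ-≤ 2 3s≤τ))
        where
        arith : ∀ s → 2 * (3 * s) ≡ 2 * s + (2 * s + 2 * s)
        arith = solve-∀

-- Matchings in 3-graphs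

record TripleSystem (n : ℕ) : Set where
  field
    tri        : Fin n → Fin n → Fin n → Bool
    tri-irr    : ∀ x y → tri x x y ≡ false
    tri-swapˡ  : ∀ x y z → tri x y z ≡ tri y x z
    tri-swapʳ  : ∀ x y z → tri x y z ≡ tri x z y

  link : Fin n → Graph n
  link x .adj = tri x
  link x .adj-irr v = trans (tri-swapˡ x v v) (trans (tri-swapʳ v x v) (tri-irr v x))
  link x .adj-sym = tri-swapʳ x

  tri-cycle : ∀ x y z → tri y z x ≡ tri x y z
  tri-cycle x y z = trans (tri-swapʳ y z x) (tri-swapˡ y x z)

  -- Ordered triples, hence six times the number of triples.
  volume : ℕ
  volume = ∑[ x < n ] size (link x)

  record Matching (m : ℕ) : Set where
    field
      vertex    : Fin m → Fin 3 → Fin n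
      injective : ∀ {i j p q} → vertex i p ≡ vertex j q → i ≡ j × p ≡ q
      matched   : ∀ i → tri (vertex i 0F) (vertex i 1F) (vertex i 2F) ≡ true

    Free : Fin n → Set
    Free v = ∀ i p → vertex i p ≢ v

  open Matching

  tri⇒≢ˡ : ∀ {x y z} → tri x y z ≡ true → x ≢ y
  tri⇒≢ˡ {x} {z = z} e refl = contradiction (trans (sym e) (tri-irr x z)) λ ()

  tri⇒≢ʳ : ∀ {x y z} → tri x y z ≡ true → x ≢ z
  tri⇒≢ʳ e = tri⇒≢ˡ (trans (tri-swapʳ _ _ _) e)

  triple : Fin n → Fin n → Fin n → Fin 3 → Fin n
  triple x y z 0F = x
  triple x y z 1F = y
  triple x y z 2F = z

  triple-injective : ∀ {x y z} → tri x y z ≡ true → ∀ {p q} → triple x y z p ≡ triple x y z q → p ≡ q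
  triple-injective e {0F} {0F} _ = refl
  triple-injective e {0F} {1F} x≡y = ⊥-elim (tri⇒≢ˡ e x≡y)
  triple-injective e {0F} {2F} x≡z = ⊥-elim (tri⇒≢ʳ e x≡z)
  triple-injective e {1F} {0F} y≡x = ⊥-elim (tri⇒≢ˡ e (sym y≡x))
  triple-injective e {1F} {1F} _ = refl
  triple-injective e {1F} {2F} y≡z = ⊥-elim (adj⇒≢ (link _) e y≡z)
  triple-injective e {2F} {0F} z≡x = ⊥-elim (tri⇒≢ʳ e (sym z≡x))
  triple-injective e {2F} {1F} z≡y = ⊥-elim (adj⇒≢ (link _) e (sym z≡y))
  triple-injective e {2F} {2F} _ = refl

  triple-elim : ∀ {ℓ} (P : Fin n → Set ℓ) {x y z} → P x → P y → P z → ∀ p → P (triple x y z p)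
  triple-elim P a b c 0F = a
  triple-elim P a b c 1F = b
  triple-elim P a b c 2F = c

  extend : ∀ {m} (M : Matching m) {x y z} → tri x y z ≡ true → Free M x → Free M y → Free M z →
           Matching (suc m)
  extend {m} M {x} {y} {z} e fx fy fz = record { vertex = ψ ; injective = inj ; matched = mat }
    where
    ψ : Fin (suc m) → Fin 3 → Fin n
    ψ zero = triple x y z
    ψ (suc i) = vertex M i
    free : ∀ p → Free M (triple x y z p)
    free = triple-elim (Free M) fx fy fz
    inj : ∀ {i j p q} → ψ i p ≡ ψ j q → i ≡ j × p ≡ q
    inj {zero} {zero} eq = refl , triple-injective e eq
    inj {zero} {suc j} {p} {q} eq = ⊥-elim (free p j q (sym eq))
    inj {suc i} {zero} {p} {q} eq = ⊥-elim (free q i p eq)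
    inj {suc i} {suc j} eq with injective M eq
    ... | refl , refl = refl , refl
    mat : ∀ i → tri (ψ i 0F) (ψ i 1F) (ψ i 2F) ≡ true
    mat zero = e
    mat (suc i) = matched M i

  module Replace {m} (M : Matching m) (i : Fin m) (p : Fin 3) {y z : Fin n}
    (e : tri (vertex M i p) y z ≡ true) (fy : Free M y) (fz : Free M z) where

    private
      new : Fin 3 → Fin n
      new = triple (vertex M i p) y z

      ψ : Fin m → Fin 3 → Fin n
      ψ j with j Fin.≟ i
      ... | yes _ = new
      ... | no _ = vertex M j

      foreign : ∀ {j q} k → j ≢ i → new k ≢ vertex M j q
      foreign {j} {q} = triple-elim (λ v → j ≢ i → v ≢ vertex M j q)
        (λ j≢i eq → j≢i (sym (proj₁ (injective M eq)))) (λ _ eq → fy j q (sym eq)) (λ _ eq → fz j q (sym eq))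

    replaced : Matching m
    replaced .vertex = ψ
    replaced .injective {j} {k} eq with j Fin.≟ i | k Fin.≟ i
    ... | yes refl | yes refl = refl , triple-injective e eq
    ... | yes refl | no k≢i = ⊥-elim (foreign _ k≢i eq)
    ... | no j≢i | yes refl = ⊥-elim (foreign _ j≢i (sym eq))
    ... | no _ | no _ = injective M eq
    replaced .matched j with j Fin.≟ i
    ... | yes refl = e
    ... | no _ = matched M j

    unchanged : ∀ {j} → j ≢ i → ∀ q → vertex replaced j q ≡ vertex M j q
    unchanged {j} j≢i q with j Fin.≟ i
    ... | yes refl = ⊥-elim (j≢i refl)
    ... | no _ = refl

    freed : ∀ {v} → v ≢ vertex M i p → v ≢ y → v ≢ z → (∀ j → j ≢ i → ∀ q → vertex M j q ≢ v) →
            Free replaced v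
    freed {v} a b c others j q with j Fin.≟ i
    ... | yes refl = triple-elim (λ w → w ≢ v) (a ∘ sym) (b ∘ sym) (c ∘ sym) q
    ... | no j≢i = others j j≢i q

    freed-free : ∀ {v} → v ≢ y → v ≢ z → Free M v → Free replaced v
    freed-free v≢y v≢z f = freed (λ { refl → f i p refl }) v≢y v≢z (λ j _ → f j)

    freed-member : ∀ q → q ≢ p → Free replaced (vertex M i q)
    freed-member q q≢p = freed (λ eq → q≢p (proj₂ (injective M eq))) (fy i q) (fz i q)
      λ j j≢i r eq → j≢i (proj₁ (injective M eq))

  -- Otherwise triple `i` could be exchanged for two disjoint triples, one through each of its
  -- vertices `p` and `q`.
  cross-free : ∀ {m} → ¬ Matching (suc m) → (M : Matching m) → ∀ i {p q y z y′ z′} → p ≢ q →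
               tri (vertex M i p) y z ≡ true → tri (vertex M i q) y′ z′ ≡ true →
               Free M y → Free M z → Free M y′ → Free M z′ → ¬ Disjoint y z y′ z′
  cross-free max M i {p} {q} p≢q e e′ fy fz fy′ fz′ ((yy′ , yz′) , (zy′ , zz′)) =
    max (extend replaced e′ (freed-member q (p≢q ∘ sym))
      (freed-free (yy′ ∘ sym) (zy′ ∘ sym) fy′) (freed-free (yz′ ∘ sym) (zz′ ∘ sym) fz′))
    where open Replace M i p e fy fz

open TripleSystem
open Matching

-- Rich triples and the freeing of weak vertices

module _ {s t : ℕ} (4≤s : 4 ≤ s) (3s≤t : 3 * s ≤ t) {n} (H : TripleSystem n)
  (codegree : ∀ x y → deg (link H x) y ≤ s) where
  module Clearing {m} (M : Matching H m) where

    opaque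
      covered : Fin n → Bool
      covered v = does (Fin.any? λ i → Fin.any? λ p → vertex M i p Fin.≟ v)

      covered-free : ∀ {v} → covered v ≡ false → Free M v
      covered-free {v} c i p eq = contradiction
        (trans (sym (dec-true (Fin.any? λ i → Fin.any? λ p → vertex M i p Fin.≟ v) (i , p , eq))) c) λ ()

      free-covered : ∀ {v} → Free M v → covered v ≡ false
      free-covered {v} f = dec-false (Fin.any? λ i → Fin.any? λ p → vertex M i p Fin.≟ v)
        λ (i , p , eq) → f i p eq

    external : Fin m → Fin 3 → Graph n
    external i p = delete (link H (vertex M i p)) covered

    external-adj : ∀ i p {y z} → adj (external i p) y z ≡ true →
                   tri H (vertex M i p) y z ≡ true × Free M y × Free M z
    external-adj i p {y} {z} e with tri H (vertex M i p) y z | covered y in cy | covered z in cz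
    ... | true | false | false = refl , covered-free cy , covered-free cz

    deg-external : ∀ i p v → deg (external i p) v ≤ s
    deg-external i p v = ≤-trans (deg-delete {G = link H (vertex M i p)} {covered} v) (codegree _ v)

    Strong : Fin m → Fin 3 → Set
    Strong i p = 2 * t < size (external i p)

    Rich : Fin m → Set
    Rich i = ∃ (Strong i)

    module Loosening (rich? : ∀ i → Dec (Rich i)) where

      -- A rich triple may have several vertices with a large external link. The decision `rich?`
      -- picks one of them, and the other two count as weak in any case.
      Chosen : Fin m → Fin 3 → Set
      Chosen i p = ∃ λ (big : Strong i p) → rich? i ≡ yes (p , big)

      Chosen-unique : ∀ {i p p′} → Chosen i p → Chosen i p′ → p ≡ p′
      Chosen-unique (_ , e) (_ , e′) with trans (sym e) e′
      ... | refl = refl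

      Weak : Fin n → Set
      Weak v = ∃ λ i → ∃₂ λ p q → Chosen i p × q ≢ p × vertex M i q ≡ v

      Loose : Fin n → Set
      Loose v = Free M v ⊎ Weak v

      -- Poor triples have to stay in place, so that an exchange at one of them can follow.
      Clears : Matching H m → List (Fin n) → Set
      Clears M′ vs = (∀ {i} → ¬ Rich i → ∀ q → vertex M′ i q ≡ vertex M i q) × All (Free M′) vs

      opaque
        -- The external link has more than `t`, so more than `3 * s`, edges, and three vertices meet
        -- at most `3 * s` of them.
        strong-escape : ∀ i p → Strong i p → ∀ vs → length vs ≤ 3 →
          ∃₂ λ y z → tri H (vertex M i p) y z ≡ true × Free M y × Free M z × All (Avoids y z) vs
        strong-escape i p big vs short with escape (external i p) (deg-external i p) vs [] (≤-<-trans bound big)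
          where
          bound : length vs * (2 * s) + 0 ≤ 2 * t
          bound = begin
            length vs * (2 * s) + 0   ≤⟨ +-monoˡ-≤ 0 (*-monoˡ-≤ (2 * s) short) ⟩
            3 * (2 * s) + 0           ≡⟨ swap s ⟩
            2 * (3 * s)               ≤⟨ *-monoʳ-≤ 2 3s≤t ⟩
            2 * t                     ∎
            where
            open ≤-Reasoning
            swap : ∀ s → 3 * (2 * s) + 0 ≡ 2 * (3 * s)
            swap = solve-∀
        ... | y , z , e , avoids , _ = let e′ , fy , fz = external-adj i p e in y , z , e′ , fy , fz , avoids

      -- Moving a rich triple to an external edge of the link of its strong vertex frees its weak vertices.
      opaque
        clear-one : ∀ {i p} → Chosen i p → ∀ vs → length vs ≤ 3 → All (Free M) vs →
                    ∃ λ M′ → Clears M′ vs × ∀ q → q ≢ p → Free M′ (vertex M i q)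
        clear-one {i} {p} (big , _) vs short free with strong-escape i p big vs short
        ... | y , z , e , fy , fz , avoids = replaced ,
              ((λ ¬rich → unchanged λ { refl → ¬rich (p , big) }) ,
               All.zipWith (λ ((y≢v , z≢v) , f) → freed-free (y≢v ∘ sym) (z≢v ∘ sym) f) (avoids , free)) ,
              freed-member
          where open Replace H M i p e fy fz

      opaque
        -- Both triples are moved, which needs disjoint external edges. Removing the at most two
        -- vertices of `vs` takes at most `2 * s` edges from each link, so more than `s` remain and
        -- `disjoint-edges` applies.
        clear-two : ∀ {i p l r} → Chosen i p → Chosen l r → i ≢ l → ∀ vs → length vs ≤ 2 → All (Free M) vs →
                    ∃ λ M′ → Clears M′ vs × (∀ q → q ≢ p → Free M′ (vertex M i q)) ×
                                            (∀ q → q ≢ r → Free M′ (vertex M l q))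
        clear-two {i} {p} {l} {r} (big , _) (big′ , _) i≢l vs short free
          with disjoint-edges 4≤s (removeAll (external i p) vs) (removeAll (external l r) vs)
                 (λ v → ≤-trans (deg-removeAll vs _ v) (deg-external i p v))
                 (λ v → ≤-trans (deg-removeAll vs _ v) (deg-external l r v))
                 (remains i p big) (≤-<-trans (*-monoʳ-≤ 2 4≤s) (remains l r big′))
          where
          remains : ∀ i p → Strong i p → 2 * s < size (removeAll (external i p) vs)
          remains i p big = +-cancelˡ-< (2 * (2 * s)) _ _ (begin-strict
            2 * (2 * s) + 2 * s       ≡⟨ six s ⟩
            2 * (3 * s)               ≤⟨ *-monoʳ-≤ 2 3s≤t ⟩
            2 * t                     <⟨ big ⟩
            size (external i p)       ≤⟨ size-removeAll vs (external i p) (deg-external i p) ⟩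
            length vs * (2 * s) + R   ≤⟨ +-monoˡ-≤ R (*-monoˡ-≤ (2 * s) short) ⟩
            2 * (2 * s) + R           ∎)
            where
            open ≤-Reasoning
            R : ℕ
            R = size (removeAll (external i p) vs)
            six : ∀ s → 2 * (2 * s) + 2 * s ≡ 2 * (3 * s)
            six = solve-∀
        ... | a , b , c , e , ab , ce , ((a≢c , a≢e) , (b≢c , b≢e))
          with adj-removeAll vs (external i p) ab | adj-removeAll vs (external l r) ce
        ...   | ab′ , avoids | ce′ , avoids′ with external-adj i p ab′ | external-adj l r ce′
        ...     | tab , fa , fb | tce , fc , fe = N.replaced ,
                  ((λ {k} ¬rich q → trans (N.unchanged {k} (λ { refl → ¬rich (r , big′) }) q)
                                      (L.unchanged {k} (λ { refl → ¬rich (p , big) }) q)) ,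
                   All.zipWith (λ ((av , av′) , f) → N-free av′ (L-free av f)) (All.zip (avoids , avoids′) , free)) ,
                  (λ q q≢p → N-free ((λ { refl → fc i q refl }) , (λ { refl → fe i q refl })) (L.freed-member q q≢p)) ,
                  (λ q q≢r → subst (Free N.replaced) (L.unchanged (i≢l ∘ sym) q) (N.freed-member q q≢r))
          where
          module L = Replace H M i p tab fa fb
          module N = Replace H L.replaced l r
            (subst (λ v → tri H v c e ≡ true) (sym (L.unchanged (i≢l ∘ sym) r)) tce)
            (L.freed-free (a≢c ∘ sym) (b≢c ∘ sym) fc) (L.freed-free (a≢e ∘ sym) (b≢e ∘ sym) fe)
          L-free : ∀ {v} → Avoids a b v → Free M v → Free L.replaced v
          L-free (a≢v , b≢v) = L.freed-free (a≢v ∘ sym) (b≢v ∘ sym)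
          N-free : ∀ {v} → Avoids c e v → Free L.replaced v → Free N.replaced v
          N-free (c≢v , e≢v) = N.freed-free (c≢v ∘ sym) (e≢v ∘ sym)

      opaque
        -- A free vertex joins the list that is kept free, and a weak one is freed by moving its
        -- triple. Two weak vertices of one triple are freed by the same move.
        clear : ∀ {v w} → Loose v → Loose w → ∀ vs → length vs ≤ 2 → All (Free M) vs →
                ∃ λ M′ → Clears M′ (v ∷ w ∷ vs)
        clear (inj₁ fv) (inj₁ fw) vs short free = M , (λ _ _ → refl) , fv ∷ fw ∷ free
        clear (inj₁ fv) (inj₂ (i , p , q , ch , q≢p , refl)) vs short free
          with clear-one ch (_ ∷ vs) (s≤s short) (fv ∷ free)
        ... | M′ , (same , fv′ ∷ free′) , freed = M′ , same , fv′ ∷ freed q q≢p ∷ free′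
        clear (inj₂ (i , p , q , ch , q≢p , refl)) (inj₁ fw) vs short free
          with clear-one ch (_ ∷ vs) (s≤s short) (fw ∷ free)
        ... | M′ , (same , fw′ ∷ free′) , freed = M′ , same , freed q q≢p ∷ fw′ ∷ free′
        clear (inj₂ (i , p , q , ch , q≢p , refl)) (inj₂ (l , r , q′ , ch′ , q′≢r , refl)) vs short free
          with i Fin.≟ l
        ... | no i≢l with clear-two ch ch′ i≢l vs short free
        ...   | M′ , (same , free′) , freed , freed′ = M′ , same , freed q q≢p ∷ freed′ q′ q′≢r ∷ free′
        clear (inj₂ (i , p , q , ch , q≢p , refl)) (inj₂ (.i , r , q′ , ch′ , q′≢r , refl)) vs short free
            | yes refl with Chosen-unique ch ch′ | clear-one ch vs (≤-trans short (n≤1+n 2)) free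
        ...   | refl | M′ , (same , free′) , freed = M′ , same , freed q q≢p ∷ freed q′ q′≢r ∷ free′

      module _ (max : ¬ Matching H (suc m)) where

        -- Once `x` and `y` are cleared with `z` kept free, the triple would extend the matching.
        no-loose-triple : ∀ {x y z} → tri H x y z ≡ true → Loose x → Loose y → ¬ Free M z
        no-loose-triple e lx ly fz with clear lx ly (_ ∷ []) (s≤s z≤n) (fz ∷ [])
        ... | M′ , _ , fx′ ∷ fy′ ∷ fz′ ∷ [] = max (extend H M′ e fx′ fy′ fz′)

        -- Clearing `y` and `y′` leaves the poor triple in place, after which `cross-free` applies
        -- to the new matching.
        poor-cross : ∀ {i p q y z y′ z′} → ¬ Rich i → p ≢ q →
                     tri H (vertex M i p) y z ≡ true → tri H (vertex M i q) y′ z′ ≡ true →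
                     Loose y → Free M z → Loose y′ → Free M z′ → ¬ Disjoint y z y′ z′
        poor-cross {i} {p} {q} {y} {z} {y′} {z′} ¬rich p≢q e e′ ly fz ly′ fz′
          with clear ly ly′ (z ∷ z′ ∷ []) (s≤s (s≤s z≤n)) (fz ∷ fz′ ∷ [])
        ... | M′ , same , fy ∷ fy′ ∷ fz ∷ fz′ ∷ [] =
          cross-free H max M′ i p≢q (subst (λ v → tri H v y z ≡ true) (sym (same ¬rich p)) e)
            (subst (λ v → tri H v y′ z′ ≡ true) (sym (same ¬rich q)) e′) fy fz fy′ fz′

-- Counting the triples

-- Roles are elements of `Fin 4`, so that statements about all of them can be decided by
-- computation.
Role : Set
Role = Fin 4

pattern outer = 0F
pattern strong = 1F
pattern weak = 2F
pattern poor = 3F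

loose : Role → Bool
loose outer = true
loose weak = true
loose _ = false

-- The possible ends of the link edges that cross-intersect at a poor triple. Two weak ends are left
-- out, since clearing both ends of both edges would involve up to four weak vertices.
compatible : Role → Role → Bool
compatible outer b = loose b
compatible weak outer = true
compatible _ _ = false

compatible-sym : ∀ a b → compatible a b ≡ compatible b a
compatible-sym = from-yes (Fin.all? λ a → Fin.all? λ b → compatible a b Bool.≟ compatible b a)

-- The charge of a triple, doubled and split cyclically over its vertices.  The last two summands pay for
-- the second half of a triple with a single poor vertex and no strong one.
share : Role → Role → Role → ℕ
share a b c = (2 * δ strong a + δ poor a) + (δ poor a * ⟦ compatible b c ⟧ + δ weak a * δ weak b)

-- The roles that `no-loose-triple` rules out, up to rotation.
excluded : Role → Role → Role → Bool
excluded a b c = loose a ∧ loose b ∧ does (c Fin.≟ outer)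

-- All 64 combinations are checked by computation. A strong vertex or two poor ones suffice; a
-- single poor vertex is helped by a compatible pair or by a pair of weak vertices, and three weak
-- vertices contain enough such pairs.
shares≥2 : ∀ a b c → 2 ≤ share a b c + (share b c a + share c a b) ⊎
           excluded a b c ≡ true ⊎ excluded b c a ≡ true ⊎ excluded c a b ≡ true
shares≥2 = from-yes (Fin.all? λ a → Fin.all? λ b → Fin.all? λ c →
  (2 ≤? share a b c + (share b c a + share c a b)) ⊎-dec
  (excluded a b c Bool.≟ true) ⊎-dec (excluded b c a Bool.≟ true) ⊎-dec (excluded c a b Bool.≟ true))

∑∑∑-cycle : ∀ {n} (f : Fin n → Fin n → Fin n → ℕ) →
            ∑[ x < n ] ∑[ y < n ] ∑[ z < n ] f y z x ≡ ∑[ x < n ] ∑[ y < n ] ∑[ z < n ] f x y z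
∑∑∑-cycle {n} f = trans (∑-comm {n} {n} _) (sum-cong-≗ {n} λ y → ∑-comm {n} {n} _)

module Counting {s d t : ℕ} (4≤s : 4 ≤ s) (3s≤t : 3 * s ≤ t) (s+9≤t : s + 9 ≤ t) (2s+2≤t : 2 * s + 2 ≤ t)
  {n} (H : TripleSystem n) (codegree : ∀ x y → deg (link H x) y ≤ s)
  (degree : ∀ x → size (link H x) ≤ 2 * d)
  {m} (M : Matching H m) (max : ¬ Matching H (suc m))
  (rich? : ∀ i → Dec (Clearing.Rich 4≤s 3s≤t H codegree M i)) where

  open Clearing 4≤s 3s≤t H codegree M
  open Loosening rich?

  roleAt : Fin m → Fin 3 → Role
  roleAt i q with rich? i
  ... | no _ = poor
  ... | yes (p , _) = if does (p Fin.≟ q) then strong else weak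

  roleAt≢outer : ∀ i q → roleAt i q ≢ outer
  roleAt≢outer i q e with rich? i
  roleAt≢outer i q () | no _
  roleAt≢outer i q e | yes (p , _) with p Fin.≟ q
  roleAt≢outer i q () | yes _ | yes _
  roleAt≢outer i q () | yes _ | no _

  roleAt≡weak : ∀ i q → roleAt i q ≡ weak → ∃ λ p → Chosen i p × q ≢ p
  roleAt≡weak i q e with rich? i
  ... | yes (p , big) with p Fin.≟ q
  ...   | no p≢q = p , (big , refl) , p≢q ∘ sym

  opaque
    role : Fin n → Role
    role v with Fin.any? (λ i → Fin.any? λ p → vertex M i p Fin.≟ v)
    ... | yes (i , p , _) = roleAt i p
    ... | no _ = outer

    role-vertex : ∀ i p → role (vertex M i p) ≡ roleAt i p
    role-vertex i p with Fin.any? (λ j → Fin.any? λ q → vertex M j q Fin.≟ vertex M i p)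
    ... | no ¬e = ⊥-elim (¬e (i , p , refl))
    ... | yes (j , q , e) with injective M e
    ...   | refl , refl = refl

    role-cases : ∀ v → (∃₂ λ i p → vertex M i p ≡ v) ⊎ (role v ≡ outer × Free M v)
    role-cases v with Fin.any? (λ i → Fin.any? λ p → vertex M i p Fin.≟ v)
    ... | yes e = inj₁ e
    ... | no ¬e = inj₂ (refl , λ i p e → ¬e (i , p , e))

  role≡outer : ∀ {v} → role v ≡ outer → Free M v
  role≡outer {v} e with role-cases v
  ... | inj₂ (_ , f) = f
  ... | inj₁ (i , p , refl) = ⊥-elim (roleAt≢outer i p (trans (sym (role-vertex i p)) e))

  role≡weak : ∀ {v} → role v ≡ weak → Weak v
  role≡weak {v} e with role-cases v
  ... | inj₂ (e′ , _) = contradiction (trans (sym e) e′) λ ()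
  ... | inj₁ (i , q , refl) with roleAt≡weak i q (trans (sym (role-vertex i q)) e)
  ...   | p , ch , q≢p = i , p , q , ch , q≢p , refl

  role-loose : ∀ {v} → loose (role v) ≡ true → Loose v
  role-loose {v} e with role v in eq
  ... | outer = inj₁ (role≡outer eq)
  ... | weak = inj₂ (role≡weak eq)

  -- A vertex whose role is not `outer` occurs at some position of the matching.
  ∑-role : ∀ ρ → ρ ≢ outer → (g : Fin n → ℕ) →
           ∑[ v < n ] (δ ρ (role v) * g v) ≤ ∑[ i < m ] ∑[ p < 3 ] (δ ρ (roleAt i p) * g (vertex M i p))
  ∑-role ρ ρ≢outer g = begin
    ∑[ v < n ] G v
      ≤⟨ ∑-mono pointwise ⟩
    ∑[ v < n ] ∑[ i < m ] ∑[ p < 3 ] (δ (vertex M i p) v * G v)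
      ≡⟨ trans (∑-comm {n} {m} _) (sum-cong-≗ {m} λ i → ∑-comm {n} {3} λ v p → δ (vertex M i p) v * G v) ⟩
    ∑[ i < m ] ∑[ p < 3 ] ∑[ v < n ] (δ (vertex M i p) v * G v)
      ≡⟨ sum-cong-≗ {m} (λ i → sum-cong-≗ {3} λ p → trans (∑-δ (vertex M i p) G)
           (cong (λ a → δ ρ a * g (vertex M i p)) (role-vertex i p))) ⟩
    ∑[ i < m ] ∑[ p < 3 ] (δ ρ (roleAt i p) * g (vertex M i p)) ∎
    where
    open ≤-Reasoning
    G : Fin n → ℕ
    G v = δ ρ (role v) * g v
    pointwise : ∀ v → G v ≤ ∑[ i < m ] ∑[ p < 3 ] (δ (vertex M i p) v * G v)
    pointwise v with role-cases v
    ... | inj₂ (e , _) rewrite e | δ-≢ ρ≢outer = z≤n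
    ... | inj₁ (i , p , refl) = begin
      G v                                                  ≡⟨ trans (cong (_* G v) (δ-refl v)) (+-identityʳ (G v)) ⟨
      δ v v * G v                                          ≤⟨ ∑-upper (λ q → δ (vertex M i q) v * G v) p ⟩
      ∑[ q < 3 ] (δ (vertex M i q) v * G v)                ≤⟨ ∑-upper (λ j → ∑[ q < 3 ] (δ (vertex M j q) v * G v)) i ⟩
      ∑[ j < m ] ∑[ q < 3 ] (δ (vertex M j q) v * G v)     ∎

  R P : Fin m → ℕ
  R i = ⟦ does (rich? i) ⟧
  P i = ⟦ not (does (rich? i)) ⟧

  r p̄ : ℕ
  r = sum R
  p̄ = sum P

  r+p̄≡m : r + p̄ ≡ m
  r+p̄≡m = trans (sym (∑-distrib-+ {m} R P)) (trans (sum-cong-≗ {m} λ i → one (does (rich? i)))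
            (trans (∑-const m 1) (*-identityʳ m)))
    where
    one : ∀ b → ⟦ b ⟧ + ⟦ not b ⟧ ≡ 1
    one true = refl
    one false = refl

  count : Role → Fin m → ℕ
  count ρ i = ∑[ p < 3 ] δ ρ (roleAt i p)

  count-strong : ∀ i → count strong i ≤ R i
  count-strong i with rich? i
  ... | no _ = z≤n
  ... | yes (0F , _) = ≤-refl
  ... | yes (1F , _) = ≤-refl
  ... | yes (2F , _) = ≤-refl

  count-weak : ∀ i → count weak i ≤ R i * 2
  count-weak i with rich? i
  ... | no _ = z≤n
  ... | yes (0F , _) = ≤-refl
  ... | yes (1F , _) = ≤-refl
  ... | yes (2F , _) = ≤-refl

  count-poor : ∀ i → count poor i ≤ P i * 3
  count-poor i with rich? i
  ... | no _ = ≤-refl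
  ... | yes (0F , _) = ≤-refl
  ... | yes (1F , _) = ≤-refl
  ... | yes (2F , _) = ≤-refl

  ∑-role-≤ : ∀ ρ → ρ ≢ outer → (N : Fin m → ℕ) (k c : ℕ) → (∀ i → count ρ i ≤ N i * k) →
             (g : Fin n → ℕ) → (∀ v → g v ≤ c) → ∑[ v < n ] (δ ρ (role v) * g v) ≤ sum N * k * c
  ∑-role-≤ ρ ρ≢outer N k c few g g≤c = begin
    ∑[ v < n ] (δ ρ (role v) * g v)
      ≤⟨ ∑-role ρ ρ≢outer g ⟩
    ∑[ i < m ] ∑[ p < 3 ] (δ ρ (roleAt i p) * g (vertex M i p))
      ≤⟨ ∑-mono (λ i → ∑-mono λ p → *-monoʳ-≤ (δ ρ (roleAt i p)) (g≤c (vertex M i p))) ⟩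
    ∑[ i < m ] ∑[ p < 3 ] (δ ρ (roleAt i p) * c)
      ≡⟨ sum-cong-≗ {m} (λ i → *-distribʳ-sum {3} c (λ p → δ ρ (roleAt i p))) ⟨
    ∑[ i < m ] (count ρ i * c)
      ≤⟨ ∑-mono (λ i → *-monoˡ-≤ c (few i)) ⟩
    ∑[ i < m ] (N i * k * c)
      ≡⟨ trans (sum-cong-≗ {m} λ i → *-assoc (N i) k c) (sym (*-distribʳ-sum {m} (k * c) N)) ⟩
    sum N * (k * c)
      ≡⟨ *-assoc (sum N) k c ⟨
    sum N * k * c ∎
    where open ≤-Reasoning

  strong-sum : ∑[ v < n ] (δ strong (role v) * size (link H v)) ≤ r * 1 * (2 * d)
  strong-sum = ∑-role-≤ strong (λ ()) R 1 (2 * d)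
    (λ i → ≤-trans (count-strong i) (≤-reflexive (sym (*-identityʳ (R i))))) _ degree

  poor-sum : ∑[ v < n ] (δ poor (role v) * size (link H v)) ≤ p̄ * 3 * (2 * d)
  poor-sum = ∑-role-≤ poor (λ ()) P 3 (2 * d) count-poor _ degree

  weak-sum : (g : Fin n → ℕ) → (∀ v → g v ≤ s) → ∑[ v < n ] (δ weak (role v) * g v) ≤ r * 2 * s
  weak-sum = ∑-role-≤ weak (λ ()) R 2 s count-weak

  -- There are at most `r * 2` weak vertices. For a weak `x`, every other weak `y` contributes at
  -- most `s`, while `x` itself contributes nothing; this saves the `s` that is subtracted.
  weak-weak-sum : ∑[ x < n ] (δ weak (role x) * ∑[ y < n ] (δ weak (role y) * deg (link H x) y))
                  ≤ r * 2 * (r * 2 * s ∸ s)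
  weak-weak-sum = ≤-trans (∑-mono pointwise)
    (∑-role-≤ weak (λ ()) R 2 (r * 2 * s ∸ s) count-weak (λ _ → r * 2 * s ∸ s) (λ _ → ≤-refl))
    where
    open ≤-Reasoning
    pointwise : ∀ x → δ weak (role x) * ∑[ y < n ] (δ weak (role y) * deg (link H x) y)
                      ≤ δ weak (role x) * (r * 2 * s ∸ s)
    pointwise x with weak Fin.≟ role x
    ... | no _ = z≤n
    ... | yes e = +-monoˡ-≤ 0 (m+n≤o⇒m≤o∸n _ (begin
      ∑[ y < n ] (δ weak (role y) * deg (link H x) y) + s
        ≡⟨ cong (∑[ y < n ] (δ weak (role y) * deg (link H x) y) +_) (∑-δ x (λ _ → s)) ⟨
      ∑[ y < n ] (δ weak (role y) * deg (link H x) y) + ∑[ y < n ] (δ x y * s)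
        ≡⟨ ∑-distrib-+ {n} _ _ ⟨
      ∑[ y < n ] (δ weak (role y) * deg (link H x) y + δ x y * s)
        ≤⟨ ∑-mono entry ⟩
      ∑[ y < n ] (δ weak (role y) * s)
        ≤⟨ weak-sum (λ _ → s) (λ _ → ≤-refl) ⟩
      r * 2 * s ∎))
      where
      isolated : deg (link H x) x ≡ 0
      isolated = ∑-zero {n} λ z → cong ⟦_⟧ (tri-irr H x z)
      entry : ∀ y → δ weak (role y) * deg (link H x) y + δ x y * s ≤ δ weak (role y) * s
      entry y with x Fin.≟ y
      ... | yes refl rewrite isolated | *-zeroʳ (δ weak (role x)) | δ-≡ e = ≤-refl
      ... | no _ = subst (_≤ δ weak (role y) * s) (sym (+-identityʳ _))
                     (*-monoʳ-≤ (δ weak (role y)) (codegree x y))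

  looseLink : Fin n → Graph n
  looseLink x .adj y z = tri H x y z ∧ compatible (role y) (role z)
  looseLink x .adj-irr y rewrite adj-irr (link H x) y = refl
  looseLink x .adj-sym y z = cong₂ _∧_ (tri-swapʳ H x y z) (compatible-sym (role y) (role z))

  deg-looseLink : ∀ x y → deg (looseLink x) y ≤ s
  deg-looseLink x y = ≤-trans (∑-mono λ z → ⟦∧⟧≤ (tri H x y z) _) (codegree x y)

  τ : ℕ
  τ = t + r * 2 * s

  -- An edge is external, and a vertex of a poor triple has at most `t` of those, or it has a weak
  -- end, and each of the at most `r * 2` weak vertices has at most `s` neighbours in the link.
  looseLink-size : ∀ {i} → ¬ Rich i → ∀ p → size (looseLink (vertex M i p)) ≤ 2 * τ
  looseLink-size {i} ¬rich p = begin
    size (looseLink x)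
      ≤⟨ ∑-mono (λ y → ∑-mono λ z → entry y z) ⟩
    ∑[ y < n ] ∑[ z < n ] (⟦ adj (external i p) y z ⟧ + (W y * ⟦ T y z ⟧ + W z * ⟦ T z y ⟧))
      ≡⟨ sum-cong-≗ {n} (λ y → trans (∑-distrib-+ {n} _ _) (cong (deg (external i p) y +_) (∑-distrib-+ {n} _ _))) ⟩
    ∑[ y < n ] (deg (external i p) y + (∑[ z < n ] (W y * ⟦ T y z ⟧) + ∑[ z < n ] (W z * ⟦ T z y ⟧)))
      ≡⟨ trans (∑-distrib-+ {n} _ _) (cong (size (external i p) +_) (∑-distrib-+ {n} _ _)) ⟩
    size (external i p) + (∑[ y < n ] ∑[ z < n ] (W y * ⟦ T y z ⟧) + ∑[ y < n ] ∑[ z < n ] (W z * ⟦ T z y ⟧))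
      ≡⟨ cong (λ k → size (external i p) + (∑[ y < n ] ∑[ z < n ] (W y * ⟦ T y z ⟧) + k)) (∑-comm {n} {n} _) ⟩
    size (external i p) + (∑[ y < n ] ∑[ z < n ] (W y * ⟦ T y z ⟧) + ∑[ y < n ] ∑[ z < n ] (W y * ⟦ T y z ⟧))
      ≡⟨ cong (λ k → size (external i p) + (k + k)) (sum-cong-≗ {n} λ y → sym (*-distribˡ-sum {n} (W y) _)) ⟩
    size (external i p) + (S + S)
      ≤⟨ +-mono-≤ (≮⇒≥ λ big → ¬rich (p , big)) (+-mono-≤ S≤ S≤) ⟩
    2 * t + (r * 2 * s + r * 2 * s)
      ≡⟨ collect t (r * 2 * s) ⟩
    2 * τ ∎
    where
    open ≤-Reasoning
    x = vertex M i p
    T = tri H x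
    W : Fin n → ℕ
    W y = δ weak (role y)
    S = ∑[ y < n ] (W y * deg (link H x) y)
    S≤ : S ≤ r * 2 * s
    S≤ = weak-sum (deg (link H x)) (codegree x)
    collect : ∀ a b → 2 * a + (b + b) ≡ 2 * (a + b)
    collect = solve-∀
    entry : ∀ y z → ⟦ adj (looseLink x) y z ⟧ ≤ ⟦ adj (external i p) y z ⟧ + (W y * ⟦ T y z ⟧ + W z * ⟦ T z y ⟧)
    entry y z rewrite tri-swapʳ H x z y with tri H x y z | role y in ey | role z in ez
    ... | false | _      | _      = z≤n
    ... | true  | outer  | outer  rewrite free-covered (role≡outer ey) | free-covered (role≡outer ez) = ≤-refl
    ... | true  | outer  | strong = z≤n
    ... | true  | outer  | weak   = m≤n+m 1 _
    ... | true  | outer  | poor   = z≤n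
    ... | true  | weak   | outer  = m≤n+m 1 _
    ... | true  | weak   | strong = z≤n
    ... | true  | weak   | weak   = z≤n
    ... | true  | weak   | poor   = z≤n
    ... | true  | strong | _      = z≤n
    ... | true  | poor   | _      = z≤n

  looseLink-adj : ∀ {x y z} → adj (looseLink x) y z ≡ true →
                  tri H x y z ≡ true × (Loose y × Free M z ⊎ Loose z × Free M y)
  looseLink-adj {x} {y} {z} e with tri H x y z | role y in ey | role z in ez
  ... | true | outer | outer = refl , inj₁ (inj₁ (role≡outer ey) , role≡outer ez)
  ... | true | outer | weak  = refl , inj₂ (inj₂ (role≡weak ez) , role≡outer ey)
  ... | true | weak  | outer = refl , inj₁ (inj₂ (role≡weak ey) , role≡outer ez)

  looseLink-cross : ∀ {i} → ¬ Rich i → ∀ {p q} → p ≢ q →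
                    CrossIntersecting (looseLink (vertex M i p)) (looseLink (vertex M i q))
  looseLink-cross {i} ¬rich {p} {q} p≢q {y} {z} {y′} {z′} e e′ ((a , b) , (c , f))
    with looseLink-adj {vertex M i p} {y} {z} e | looseLink-adj {vertex M i q} {y′} {z′} e′
  ... | T , inj₁ (ly , fz) | T′ , inj₁ (ly′ , fz′) =
        poor-cross max ¬rich p≢q T T′ ly fz ly′ fz′ ((a , b) , (c , f))
  ... | T , inj₁ (ly , fz) | T′ , inj₂ (lz′ , fy′) =
        poor-cross max ¬rich p≢q T (trans (tri-swapʳ H _ _ _) T′) ly fz lz′ fy′ ((b , a) , (f , c))
  ... | T , inj₂ (lz , fy) | T′ , inj₁ (ly′ , fz′) =
        poor-cross max ¬rich p≢q (trans (tri-swapʳ H _ _ _) T) T′ lz fy ly′ fz′ ((c , f) , (a , b))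
  ... | T , inj₂ (lz , fy) | T′ , inj₂ (lz′ , fy′) =
        poor-cross max ¬rich p≢q (trans (tri-swapʳ H _ _ _) T) (trans (tri-swapʳ H _ _ _) T′)
          lz fy lz′ fy′ ((f , c) , (b , a))

  -- The loose links at the three vertices of a poor triple cross-intersect, so together they stay
  -- within the bound for a single one.
  looseLink-sum : ∑[ v < n ] (δ poor (role v) * size (looseLink v)) ≤ p̄ * (2 * τ)
  looseLink-sum = begin
    ∑[ v < n ] (δ poor (role v) * size (looseLink v))
      ≤⟨ ∑-role poor (λ ()) (λ v → size (looseLink v)) ⟩
    ∑[ i < m ] ∑[ p < 3 ] (δ poor (roleAt i p) * size (looseLink (vertex M i p)))
      ≤⟨ ∑-mono three ⟩
    ∑[ i < m ] (P i * (2 * τ))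
      ≡⟨ *-distribʳ-sum {m} (2 * τ) P ⟨
    p̄ * (2 * τ) ∎
    where
    open ≤-Reasoning
    F : Fin m → Fin 3 → Graph n
    F i p = looseLink (vertex M i p)
    cross : ∀ i → ¬ Rich i → size (F i 0F) + (size (F i 1F) + size (F i 2F)) ≤ 2 * τ
    cross i ¬rich = cross-sum 4≤s (≤-trans 3s≤t (m≤m+n t _)) (≤-trans s+9≤t (m≤m+n t _)) (≤-trans 2s+2≤t (m≤m+n t _))
      {F i 0F} {F i 1F} {F i 2F} (deg-looseLink _) (deg-looseLink _) (deg-looseLink _)
      (looseLink-cross ¬rich λ ()) (looseLink-cross ¬rich λ ()) (looseLink-cross ¬rich λ ())
      (looseLink-size ¬rich 0F) (looseLink-size ¬rich 1F) (looseLink-size ¬rich 2F)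
    vanish : ∀ i big q → rich? i ≡ yes big → δ poor (roleAt i q) * size (F i q) ≡ 0
    vanish i big q e rewrite e with proj₁ big Fin.≟ q
    ... | yes _ = refl
    ... | no _ = refl
    three : ∀ i → ∑[ p < 3 ] (δ poor (roleAt i p) * size (F i p)) ≤ P i * (2 * τ)
    three i = helper (rich? i) refl
      where
      helper : ∀ d → rich? i ≡ d → ∑[ p < 3 ] (δ poor (roleAt i p) * size (F i p)) ≤ ⟦ not (does d) ⟧ * (2 * τ)
      helper (yes big) e = ≤-reflexive (∑-zero {3} λ q → vanish i big q e)
      helper (no ¬rich) e = begin
        ∑[ p < 3 ] (δ poor (roleAt i p) * size (F i p))      ≤⟨ ∑-mono (λ p → ⟦⟧*≤ (does (poor Fin.≟ roleAt i p)) (size (F i p))) ⟩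
        size (F i 0F) + (size (F i 1F) + (size (F i 2F) + 0)) ≡⟨ cong (λ k → size (F i 0F) + (size (F i 1F) + k)) (+-identityʳ _) ⟩
        size (F i 0F) + (size (F i 1F) + size (F i 2F))      ≤⟨ cross i ¬rich ⟩
        2 * τ                                                ≡⟨ +-identityʳ (2 * τ) ⟨
        2 * τ + 0                                            ∎

  charge : Fin n → Fin n → Fin n → ℕ
  charge x y z = ⟦ tri H x y z ⟧ * share (role x) (role y) (role z)

  -- Combinations of roles with a smaller share do not occur among the triples of the system.
  charge≥2 : ∀ x y z → 2 * ⟦ tri H x y z ⟧ ≤ charge x y z + (charge y z x + charge z x y)
  charge≥2 x y z with tri H x y z in e
  ... | false = z≤n
  ... | true rewrite trans (tri-cycle H x y z) e | trans (sym (tri-cycle H z x y)) e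
    with shares≥2 (role x) (role y) (role z)
  ...   | inj₁ enough = subst (2 ≤_) (unit (share (role x) (role y) (role z))
            (share (role y) (role z) (role x)) (share (role z) (role x) (role y))) enough
    where
    unit : ∀ a b c → a + (b + c) ≡ 1 * a + (1 * b + 1 * c)
    unit = solve-∀
  ...   | inj₂ excl = ⊥-elim (impossible excl)
    where
    refute : ∀ {x y z} → tri H x y z ≡ true → excluded (role x) (role y) (role z) ≢ true
    refute {x} {y} {z} T ex with ∧-true {loose (role x)} ex
    ... | lx , rest with ∧-true {loose (role y)} rest
    ...   | ly , oz with role z Fin.≟ outer
    ...     | yes fz = no-loose-triple max T (role-loose lx) (role-loose ly) (role≡outer fz)
    impossible : ¬ (excluded (role x) (role y) (role z) ≡ true ⊎ excluded (role y) (role z) (role x) ≡ true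
                    ⊎ excluded (role z) (role x) (role y) ≡ true)
    impossible (inj₁ ex) = refute e ex
    impossible (inj₂ (inj₁ ex)) = refute (trans (tri-cycle H x y z) e) ex
    impossible (inj₂ (inj₂ ex)) = refute (trans (sym (tri-cycle H z x y)) e) ex

  total : ℕ
  total = ∑[ x < n ] ∑[ y < n ] ∑[ z < n ] charge x y z

  -- The charge of an ordered triple is collected over its three rotations, and rotation permutes
  -- the ordered triples.
  volume≤total : 2 * volume H ≤ 3 * total
  volume≤total = begin
    2 * volume H
      ≡⟨ trans (*-distribˡ-sum {n} 2 _) (sum-cong-≗ {n} λ x → trans (*-distribˡ-sum {n} 2 _)
           (sum-cong-≗ {n} λ y → *-distribˡ-sum {n} 2 _)) ⟩
    ∑[ x < n ] ∑[ y < n ] ∑[ z < n ] (2 * ⟦ tri H x y z ⟧)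
      ≤⟨ ∑-mono (λ x → ∑-mono λ y → ∑-mono λ z → charge≥2 x y z) ⟩
    ∑[ x < n ] ∑[ y < n ] ∑[ z < n ] (charge x y z + (charge y z x + charge z x y))
      ≡⟨ split charge _ ⟩
    total + ∑[ x < n ] ∑[ y < n ] ∑[ z < n ] (charge y z x + charge z x y)
      ≡⟨ cong (total +_) (split (λ x y z → charge y z x) _) ⟩
    total + (∑[ x < n ] ∑[ y < n ] ∑[ z < n ] charge y z x + ∑[ x < n ] ∑[ y < n ] ∑[ z < n ] charge z x y)
      ≡⟨ cong (total +_) (cong₂ _+_ once (trans (∑∑∑-cycle (λ x y z → charge y z x)) once)) ⟩
    total + (total + total)
      ≡⟨ cong (λ k → total + (total + k)) (+-identityʳ total) ⟨
    3 * total ∎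
    where
    open ≤-Reasoning
    once = ∑∑∑-cycle charge
    split : ∀ (f g : Fin n → Fin n → Fin n → ℕ) →
            ∑[ x < n ] ∑[ y < n ] ∑[ z < n ] (f x y z + g x y z) ≡
            ∑[ x < n ] ∑[ y < n ] ∑[ z < n ] f x y z + ∑[ x < n ] ∑[ y < n ] ∑[ z < n ] g x y z
    split f g = trans (sum-cong-≗ {n} λ x → trans (sum-cong-≗ {n} λ y → ∑-distrib-+ {n} (f x y) (g x y))
                  (∑-distrib-+ {n} _ _)) (∑-distrib-+ {n} _ _)

  -- The four summands belong to the strong vertices, the poor vertices, the loose links at poor
  -- vertices and the pairs of weak vertices.
  total≤ : total ≤ 2 * (r * 1 * (2 * d)) + p̄ * 3 * (2 * d) + (p̄ * (2 * τ) + r * 2 * (r * 2 * s ∸ s))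
  total≤ = begin
    total
      ≡⟨ sum-cong-≗ {n} row ⟩
    ∑[ x < n ] ((2 * S x + Q x) * L x + (Q x * size (looseLink x) + W x * V x))
      ≡⟨ sum-cong-≗ {n} (λ x → cong (_+ (Q x * size (looseLink x) + W x * V x)) (spread (S x) (Q x) (L x))) ⟩
    ∑[ x < n ] (2 * (S x * L x) + Q x * L x + (Q x * size (looseLink x) + W x * V x))
      ≡⟨ trans (∑-distrib-+ {n} _ _) (cong₂ _+_ (∑-distrib-+ {n} _ _) (∑-distrib-+ {n} _ _)) ⟩
    ∑[ x < n ] (2 * (S x * L x)) + ∑[ x < n ] (Q x * L x) +
      (∑[ x < n ] (Q x * size (looseLink x)) + ∑[ x < n ] (W x * V x))
      ≡⟨ cong (λ k → k + ∑[ x < n ] (Q x * L x) + (∑[ x < n ] (Q x * size (looseLink x)) + ∑[ x < n ] (W x * V x)))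
           (sym (*-distribˡ-sum {n} 2 _)) ⟩
    2 * ∑[ x < n ] (S x * L x) + ∑[ x < n ] (Q x * L x) +
      (∑[ x < n ] (Q x * size (looseLink x)) + ∑[ x < n ] (W x * V x))
      ≤⟨ +-mono-≤ (+-mono-≤ (*-monoʳ-≤ 2 strong-sum) poor-sum) (+-mono-≤ looseLink-sum weak-weak-sum) ⟩
    2 * (r * 1 * (2 * d)) + p̄ * 3 * (2 * d) + (p̄ * (2 * τ) + r * 2 * (r * 2 * s ∸ s)) ∎
    where
    open ≤-Reasoning
    S Q W L V : Fin n → ℕ
    S x = δ strong (role x)
    Q x = δ poor (role x)
    W x = δ weak (role x)
    L x = size (link H x)
    V x = ∑[ y < n ] (W y * deg (link H x) y)
    spread : ∀ a b c → (2 * a + b) * c ≡ 2 * (a * c) + b * c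
    spread = solve-∀
    linear : ∀ a b c (f g h : Fin n → ℕ) →
             ∑[ i < n ] (a * f i + (b * g i + c * h i)) ≡ a * sum f + (b * sum g + c * sum h)
    linear a b c f g h = trans (∑-distrib-+ {n} _ _) (cong₂ _+_ (sym (*-distribˡ-sum {n} a f))
      (trans (∑-distrib-+ {n} _ _) (cong₂ _+_ (sym (*-distribˡ-sum {n} b g)) (sym (*-distribˡ-sum {n} c h)))))
    distribute : ∀ T c a b w w′ → ⟦ T ⟧ * (a + (b * ⟦ c ⟧ + w * w′)) ≡
                 a * ⟦ T ⟧ + (b * ⟦ T ∧ c ⟧ + w * (w′ * ⟦ T ⟧))
    distribute true c a b w w′ rewrite *-identityʳ a | *-identityʳ w′ = +-identityʳ _
    distribute false c a b w w′ rewrite *-zeroʳ a | *-zeroʳ b | *-zeroʳ w′ | *-zeroʳ w = refl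
    row : ∀ x → ∑[ y < n ] ∑[ z < n ] charge x y z ≡
                (2 * S x + Q x) * L x + (Q x * size (looseLink x) + W x * V x)
    row x = trans (sum-cong-≗ {n} λ y →
        trans (sum-cong-≗ {n} λ z → distribute (tri H x y z) (compatible (role y) (role z)) (2 * S x + Q x) (Q x) (W x) (W y))
          (trans (linear (2 * S x + Q x) (Q x) (W x) _ _ (λ z → W y * ⟦ tri H x y z ⟧))
            (cong (λ k → (2 * S x + Q x) * deg (link H x) y + (Q x * deg (looseLink x) y + W x * k))
              (sym (*-distribˡ-sum {n} (W y) _)))))
      (linear (2 * S x + Q x) (Q x) (W x) (deg (link H x)) (deg (looseLink x)) (λ y → W y * deg (link H x) y))

  -- Apart from the effect of weak vertices, a poor triple costs `2 * (3 * d + t)` and a rich one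
  -- `4 * d`. By `m ≤ s` and the hypothesis on `2 * (s * s)`, charging that effect to the rich
  -- triples raises none of them above the cost of a poor one.
  volume-bound-maximum : m ≤ s → 2 * (s * s) ≤ d + t + s → volume H ≤ 3 * (s * (3 * d + t))
  volume-bound-maximum m≤s 2s²≤ = *-cancelˡ-≤ 2 (begin
    2 * volume H                     ≤⟨ volume≤total ⟩
    3 * total                        ≤⟨ *-monoʳ-≤ 3 (+-cancelʳ-≤ (r * 2 * s) _ _ bound) ⟩
    3 * (2 * (s * (3 * d + t)))      ≡⟨ swap (s * (3 * d + t)) ⟩
    2 * (3 * (s * (3 * d + t)))      ∎)
    where
    open ≤-Reasoning
    swap : ∀ a → 3 * (2 * a) ≡ 2 * (3 * a)
    swap = solve-∀
    -- Adding `r * 2 * s` undoes the truncated subtraction; for `r` zero both sides vanish.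
    pairs : ∀ r → r * 2 * (r * 2 * s ∸ s) + r * 2 * s ≤ r * 2 * (r * 2 * s)
    pairs zero = z≤n
    pairs r@(suc _) = ≤-reflexive (trans (sym (*-distribˡ-+ (r * 2) (r * 2 * s ∸ s) s))
                        (cong (r * 2 *_) (m∸n+n≡m (m≤m+n s _))))
    regroup : ∀ r p d t s → 2 * (r * 1 * (2 * d)) + p * 3 * (2 * d) + (p * (2 * (t + r * 2 * s)) + r * 2 * (r * 2 * s)) ≡
              4 * (r * d) + 2 * (p * (3 * d + t)) + 4 * (r * s) * (r + p)
    regroup = solve-∀
    collect : ∀ r p d t s → 4 * (r * d) + 2 * (p * (3 * d + t)) + 2 * r * (d + t + s) ≡
              2 * ((r + p) * (3 * d + t)) + r * 2 * s
    collect = solve-∀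
    square : ∀ r s → 4 * (r * s) * s ≡ 2 * r * (2 * (s * s))
    square = solve-∀
    r+p̄≤s : r + p̄ ≤ s
    r+p̄≤s = ≤-trans (≤-reflexive r+p̄≡m) m≤s
    bound : total + r * 2 * s ≤ 2 * (s * (3 * d + t)) + r * 2 * s
    bound = begin
      total + r * 2 * s
        ≤⟨ +-monoˡ-≤ (r * 2 * s) total≤ ⟩
      A + (p̄ * (2 * τ) + r * 2 * (r * 2 * s ∸ s)) + r * 2 * s
        ≡⟨ trans (+-assoc A _ _) (cong (A +_) (+-assoc (p̄ * (2 * τ)) _ _)) ⟩
      A + (p̄ * (2 * τ) + (r * 2 * (r * 2 * s ∸ s) + r * 2 * s))
        ≤⟨ +-monoʳ-≤ A (+-monoʳ-≤ (p̄ * (2 * τ)) (pairs r)) ⟩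
      A + (p̄ * (2 * τ) + r * 2 * (r * 2 * s))
        ≡⟨ regroup r p̄ d t s ⟩
      B + 4 * (r * s) * (r + p̄)
        ≤⟨ +-monoʳ-≤ B (*-monoʳ-≤ (4 * (r * s)) r+p̄≤s) ⟩
      B + 4 * (r * s) * s
        ≡⟨ cong (B +_) (square r s) ⟩
      B + 2 * r * (2 * (s * s))
        ≤⟨ +-monoʳ-≤ B (*-monoʳ-≤ (2 * r) 2s²≤) ⟩
      B + 2 * r * (d + t + s)
        ≡⟨ collect r p̄ d t s ⟩
      2 * ((r + p̄) * (3 * d + t)) + r * 2 * s
        ≤⟨ +-monoˡ-≤ (r * 2 * s) (*-monoʳ-≤ 2 (*-monoˡ-≤ (3 * d + t) r+p̄≤s)) ⟩
      2 * (s * (3 * d + t)) + r * 2 * s ∎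
      where
      A = 2 * (r * 1 * (2 * d)) + p̄ * 3 * (2 * d)
      B = 4 * (r * d) + 2 * (p̄ * (3 * d + t))

module _ {s d t : ℕ} (4≤s : 4 ≤ s) (3s≤t : 3 * s ≤ t) (s+9≤t : s + 9 ≤ t) (2s+2≤t : 2 * s + 2 ≤ t)
  (2s²≤d+t+s : 2 * (s * s) ≤ d + t + s)
  {n} (H : TripleSystem n) (codegree : ∀ x y → deg (link H x) y ≤ s)
  (degree : ∀ x → size (link H x) ≤ 2 * d) (no-matching : ¬ Matching H (suc s)) where

  -- If the bound fails, no matching of size at most `s` is maximum. So the absence of matchings
  -- passes down from size `s + 1` to size zero, where the empty matching contradicts it.
  volume-bound : volume H ≤ 3 * (s * (3 * d + t))
  volume-bound = decidable-stable (volume H ≤? 3 * (s * (3 * d + t))) λ ¬goal →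
    climb ¬goal s 0 (+-identityʳ s) (record { vertex = λ () ; injective = λ { {()} } ; matched = λ () })
    where
    climb : ¬ volume H ≤ 3 * (s * (3 * d + t)) → ∀ k m → k + m ≡ s → ¬ Matching H m
    finish : ¬ volume H ≤ 3 * (s * (3 * d + t)) → ∀ {m} → m ≤ s → ¬ Matching H (suc m) → ¬ Matching H m
    finish ¬goal m≤s max M = ¬goal (Counting.volume-bound-maximum 4≤s 3s≤t s+9≤t 2s+2≤t H codegree degree M max
      (λ i → Fin.any? λ p → 2 * t <? size (Clearing.external 4≤s 3s≤t H codegree M i p)) m≤s 2s²≤d+t+s)
    climb ¬goal zero m refl M = finish ¬goal ≤-refl no-matching M
    climb ¬goal (suc k) m eq M = finish ¬goal (≤-trans (m≤n+m m (suc k)) (≤-reflexive eq))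
      (climb ¬goal k (suc m) (trans (+-suc k m) eq)) M

-- Sunflower-free families as 3-graphs

does-true⁻ : ∀ {A : Set} (a? : Dec A) → does a? ≡ true → A
does-true⁻ (yes a) _ = a

_≟ˢ_ : ∀ {n} (p q : Subset n) → Dec (p ≡ q)
_≟ˢ_ = Vec.≡-dec Bool._≟_

trip : ∀ {n} → Fin n → Fin n → Fin n → Subset n
trip x y z = ⁅ x ⁆ ∪ (⁅ y ⁆ ∪ ⁅ z ⁆)

module _ {n : ℕ} where

  ∈-trip⁻ : ∀ {v x y z : Fin n} → v ∈ trip x y z → v ≡ x ⊎ v ≡ y ⊎ v ≡ z
  ∈-trip⁻ {v} {x} {y} {z} p with Subset.x∈p∪q⁻ ⁅ x ⁆ (⁅ y ⁆ ∪ ⁅ z ⁆) p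
  ... | inj₁ q = inj₁ (Subset.x∈⁅y⁆⇒x≡y x q)
  ... | inj₂ q with Subset.x∈p∪q⁻ ⁅ y ⁆ ⁅ z ⁆ q
  ...   | inj₁ r = inj₂ (inj₁ (Subset.x∈⁅y⁆⇒x≡y y r))
  ...   | inj₂ r = inj₂ (inj₂ (Subset.x∈⁅y⁆⇒x≡y z r))

  x∈trip : ∀ (x y z : Fin n) → x ∈ trip x y z
  x∈trip x y z = Subset.x∈p∪q⁺ (inj₁ (Subset.x∈⁅x⁆ x))

  y∈trip : ∀ (x y z : Fin n) → y ∈ trip x y z
  y∈trip x y z = Subset.x∈p∪q⁺ (inj₂ (Subset.x∈p∪q⁺ (inj₁ (Subset.x∈⁅x⁆ y))))

  z∈trip : ∀ (x y z : Fin n) → z ∈ trip x y z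
  z∈trip x y z = Subset.x∈p∪q⁺ (inj₂ (Subset.x∈p∪q⁺ (inj₂ (Subset.x∈⁅x⁆ z))))

  trip-swapˡ : ∀ (x y z : Fin n) → trip x y z ≡ trip y x z
  trip-swapˡ x y z = trans (sym (Subset.∪-assoc ⁅ x ⁆ ⁅ y ⁆ ⁅ z ⁆))
    (trans (cong (_∪ ⁅ z ⁆) (Subset.∪-comm ⁅ x ⁆ ⁅ y ⁆)) (Subset.∪-assoc ⁅ y ⁆ ⁅ x ⁆ ⁅ z ⁆))

  trip-swapʳ : ∀ (x y z : Fin n) → trip x y z ≡ trip x z y
  trip-swapʳ x y z = cong (⁅ x ⁆ ∪_) (Subset.∪-comm ⁅ y ⁆ ⁅ z ⁆)

  ∈⇒lookup : ∀ {v : Fin n} {p} → v ∈ p → Vec.lookup p v ≡ true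
  ∈⇒lookup = Vec.[]=⇒lookup

  ∩-≡ : ∀ {p q c : Subset n} → (∀ {v} → v ∈ p → v ∈ q → v ∈ c) → c ⊆ p → c ⊆ q → p ∩ q ≡ c
  ∩-≡ {p} {q} f g h = Subset.⊆-antisym
    (λ v∈ → let v∈p , v∈q = Subset.x∈p∩q⁻ p q v∈ in f v∈p v∈q)
    (λ v∈ → Subset.x∈p∩q⁺ (g v∈ , h v∈))

-- Ordered triples spanned by a 3-set

∣∣-∑ : ∀ {n} (p : Subset n) → ∣ p ∣ ≡ ∑[ v < n ] ⟦ Vec.lookup p v ⟧
∣∣-∑ Vec.[] = refl
∣∣-∑ (true Vec.∷ p) = cong suc (∣∣-∑ p)
∣∣-∑ (false Vec.∷ p) = ∣∣-∑ p

module _ {n : ℕ} (e : Subset n) where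

  Spans : Fin n → Fin n → Fin n → Set
  Spans x y z = x ≢ y × x ≢ z × y ≢ z ×
                Vec.lookup e x ≡ true × Vec.lookup e y ≡ true × Vec.lookup e z ≡ true

  opaque
    spans? : ∀ x y z → Dec (Spans x y z)
    spans? x y z = ¬? (x Fin.≟ y) ×-dec ¬? (x Fin.≟ z) ×-dec ¬? (y Fin.≟ z) ×-dec
      (Vec.lookup e x Bool.≟ true) ×-dec (Vec.lookup e y Bool.≟ true) ×-dec (Vec.lookup e z Bool.≟ true)

  module _ (∣e∣≡3 : ∣ e ∣ ≡ 3) where

    ∑-members : ∑[ v < n ] ⟦ Vec.lookup e v ⟧ ≡ 3
    ∑-members = trans (sym (∣∣-∑ e)) ∣e∣≡3

    -- Any further member of `e` would be a fourth.
    spans⇒≡ : ∀ {x y z} → Spans x y z → e ≡ trip x y z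
    spans⇒≡ {x} {y} {z} (x≢y , x≢z , y≢z , ex , ey , ez) = Subset.⊆-antisym below above
      where
      above : trip x y z ⊆ e
      above v∈ with ∈-trip⁻ v∈
      ... | inj₁ refl = Vec.lookup⇒[]= _ e ex
      ... | inj₂ (inj₁ refl) = Vec.lookup⇒[]= _ e ey
      ... | inj₂ (inj₂ refl) = Vec.lookup⇒[]= _ e ez
      fourth : ∀ {v} → Vec.lookup e v ≡ true → v ≢ x → v ≢ y → v ≢ z → ⊥
      fourth {v} ev v≢x v≢y v≢z = <⇒≱ {3} {4} ≤-refl (begin
        4
          ≡⟨ cong₂ _+_ (∑-δ v (λ _ → 1)) (cong₂ _+_ (∑-δ x (λ _ → 1)) (cong₂ _+_ (∑-δ y (λ _ → 1)) (∑-δ z (λ _ → 1)))) ⟨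
        D v + (D x + (D y + D z))
          ≡⟨ cong (D v +_) (cong (D x +_) (∑-distrib-+ {n} _ _)) ⟨
        D v + (D x + ∑[ w < n ] (δ y w * 1 + δ z w * 1))
          ≡⟨ cong (D v +_) (∑-distrib-+ {n} _ _) ⟨
        D v + ∑[ w < n ] (δ x w * 1 + (δ y w * 1 + δ z w * 1))
          ≡⟨ ∑-distrib-+ {n} _ _ ⟨
        ∑[ w < n ] (δ v w * 1 + (δ x w * 1 + (δ y w * 1 + δ z w * 1)))
          ≤⟨ ∑-mono pointwise ⟩
        ∑[ w < n ] ⟦ Vec.lookup e w ⟧
          ≡⟨ ∑-members ⟩
        3 ∎)
        where
        open ≤-Reasoning
        D : Fin n → ℕ
        D u = ∑[ w < n ] (δ u w * 1)
        pointwise : ∀ w → δ v w * 1 + (δ x w * 1 + (δ y w * 1 + δ z w * 1)) ≤ ⟦ Vec.lookup e w ⟧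
        pointwise w with v Fin.≟ w | x Fin.≟ w | y Fin.≟ w | z Fin.≟ w
        ... | yes refl | yes refl | _ | _ = ⊥-elim (v≢x refl)
        ... | yes refl | no _ | yes refl | _ = ⊥-elim (v≢y refl)
        ... | yes refl | no _ | no _ | yes refl = ⊥-elim (v≢z refl)
        ... | yes refl | no _ | no _ | no _ rewrite ev = ≤-refl
        ... | no _ | yes refl | yes refl | _ = ⊥-elim (x≢y refl)
        ... | no _ | yes refl | no _ | yes refl = ⊥-elim (x≢z refl)
        ... | no _ | yes refl | no _ | no _ rewrite ex = ≤-refl
        ... | no _ | no _ | yes refl | yes refl = ⊥-elim (y≢z refl)
        ... | no _ | no _ | yes refl | no _ rewrite ey = ≤-refl
        ... | no _ | no _ | no _ | yes refl rewrite ez = ≤-refl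
        ... | no _ | no _ | no _ | no _ = z≤n
      below : e ⊆ trip x y z
      below {v} v∈ with v Fin.≟ x | v Fin.≟ y | v Fin.≟ z
      ... | yes refl | _ | _ = x∈trip v y z
      ... | no _ | yes refl | _ = y∈trip x v z
      ... | no _ | no _ | yes refl = z∈trip x y v
      ... | no p | no q | no r = ⊥-elim (fourth (∈⇒lookup v∈) p q r)

    ∑-minus-one : ∀ x (f : Fin n → ℕ) →
                  (∀ v → ⟦ Vec.lookup e v ⟧ ≤ f v + δ x v * 1) → 3 ≤ sum f + 1
    ∑-minus-one x f p = begin
      3                                    ≡⟨ ∑-members ⟨
      ∑[ v < n ] ⟦ Vec.lookup e v ⟧        ≤⟨ ∑-mono p ⟩
      ∑[ v < n ] (f v + δ x v * 1)         ≡⟨ ∑-distrib-+ {n} f _ ⟩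
      sum f + ∑[ v < n ] (δ x v * 1)       ≡⟨ cong (sum f +_) (∑-δ x (λ _ → 1)) ⟩
      sum f + 1                            ∎
      where open ≤-Reasoning

    spanned : ℕ
    spanned = ∑[ x < n ] ∑[ y < n ] ∑[ z < n ] ⟦ does (spans? x y z) ⟧

    spanned-third : ∀ x y → x ≢ y → Vec.lookup e x ≡ true → Vec.lookup e y ≡ true →
                    1 ≤ ∑[ z < n ] ⟦ does (spans? x y z) ⟧
    spanned-third x y x≢y ex ey = +-cancelʳ-≤ 1 1 _ (+-cancelʳ-≤ 1 2 _ (≤-trans (∑-minus-one x _ pointwise)
        (≤-reflexive (cong (_+ 1) (trans (∑-distrib-+ {n} _ _) (cong (S +_) (∑-δ y (λ _ → 1))))))))
      where
      S = ∑[ z < n ] ⟦ does (spans? x y z) ⟧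
      pointwise : ∀ z → ⟦ Vec.lookup e z ⟧ ≤ ⟦ does (spans? x y z) ⟧ + δ y z * 1 + δ x z * 1
      pointwise z with x Fin.≟ z | y Fin.≟ z | Vec.lookup e z in ez
      ... | _ | _ | false = z≤n
      ... | yes refl | _ | true = m≤n+m 1 _
      ... | no _ | yes refl | true = ≤-trans (m≤n+m 1 ⟦ does (spans? x y z) ⟧) (m≤m+n _ 0)
      ... | no x≢z | no y≢z | true
        rewrite dec-true (spans? x y z) (x≢y , x≢z , y≢z , ex , ey , ez) = ≤-refl

    spanned-second : ∀ x → Vec.lookup e x ≡ true → 2 ≤ ∑[ y < n ] ∑[ z < n ] ⟦ does (spans? x y z) ⟧
    spanned-second x ex = +-cancelʳ-≤ 1 2 _ (∑-minus-one x _ pointwise)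
      where
      pointwise : ∀ y → ⟦ Vec.lookup e y ⟧ ≤ ∑[ z < n ] ⟦ does (spans? x y z) ⟧ + δ x y * 1
      pointwise y with x Fin.≟ y | Vec.lookup e y in ey
      ... | _ | false = z≤n
      ... | yes refl | true = m≤n+m 1 _
      ... | no x≢y | true = ≤-trans (spanned-third x y x≢y ex ey) (m≤m+n _ _)

    -- There are three first entries, and each leaves two choices for the second and then one for
    -- the third.
    spanned≥6 : 6 ≤ spanned
    spanned≥6 = begin
      6                                            ≡⟨ cong (2 *_) ∑-members ⟨
      2 * ∑[ x < n ] ⟦ Vec.lookup e x ⟧            ≡⟨ *-distribˡ-sum {n} 2 _ ⟩
      ∑[ x < n ] (2 * ⟦ Vec.lookup e x ⟧)          ≤⟨ ∑-mono pointwise ⟩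
      spanned                                      ∎
      where
      open ≤-Reasoning
      pointwise : ∀ x → 2 * ⟦ Vec.lookup e x ⟧ ≤ ∑[ y < n ] ∑[ z < n ] ⟦ does (spans? x y z) ⟧
      pointwise x with Vec.lookup e x in ex
      ... | true = spanned-second x ex
      ... | false = z≤n

module FamilyTriples {n s} {F : List (Subset n)} (good : IsSunflowerFree 3 (suc s) F) where
  open IsSunflowerFree good
  open DecMembership (_≟ˢ_ {n}) using (_∈?_)

  Triple : Fin n → Fin n → Fin n → Set
  Triple x y z = x ≢ y × x ≢ z × y ≢ z × trip x y z ∈ᴸ F

  opaque
    triple? : ∀ x y z → Dec (Triple x y z)
    triple? x y z = ¬? (x Fin.≟ y) ×-dec ¬? (x Fin.≟ z) ×-dec ¬? (y Fin.≟ z) ×-dec trip x y z ∈? F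

  Triple-swapˡ : ∀ {x y z} → Triple x y z → Triple y x z
  Triple-swapˡ (x≢y , x≢z , y≢z , m) = x≢y ∘ sym , y≢z , x≢z , subst (_∈ᴸ F) (trip-swapˡ _ _ _) m

  Triple-swapʳ : ∀ {x y z} → Triple x y z → Triple x z y
  Triple-swapʳ (x≢y , x≢z , y≢z , m) = x≢z , x≢y , y≢z ∘ sym , subst (_∈ᴸ F) (trip-swapʳ _ _ _) m

  system : TripleSystem n
  system .tri x y z = does (triple? x y z)
  system .tri-irr x y = dec-false (triple? x x y) λ (x≢x , _) → x≢x refl
  system .tri-swapˡ x y z = does-cong (triple? x y z) (triple? y x z) Triple-swapˡ Triple-swapˡ
  system .tri-swapʳ x y z = does-cong (triple? x y z) (triple? x z y) Triple-swapʳ Triple-swapʳ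

  tri⇒Triple : ∀ {x y z} → tri system x y z ≡ true → Triple x y z
  tri⇒Triple {x} {y} {z} = does-true⁻ (triple? x y z)

  no-sunflower : (A : Fin (suc s) → Subset n) → (∀ j → A j ∈ᴸ F) → (∀ {i j} → i ≢ j → A i ≢ A j) →
                 (c : Subset n) → (∀ j → c ⊆ A j) → (∀ {i j} → i ≢ j → ∀ {v} → v ∈ A i → v ∈ A j → v ∈ c) → ⊥
  no-sunflower A A∈F A≢ c c⊆A meet = free (A , A∈F , record
    { distinct = λ {i} {j} e → decidable-stable (i Fin.≟ j) λ i≢j → A≢ i≢j e
    ; core = c
    ; meets = λ i j i≢j → ∩-≡ (meet i≢j) (c⊆A i) (c⊆A j)
    })

  -- More than `s` triples through `x` and `y` would form a sunflower whose core consists of `x` and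
  -- `y`.
  codegree-bound : ∀ x y → deg (link system x) y ≤ s
  codegree-bound x y = ≮⇒≥ λ big → contra (∑-true⇒injection (suc s) (tri system x y) big)
    where
    contra : ¬ ∃ λ (ζ : Fin (suc s) → Fin n) → Injective _≡_ _≡_ ζ × ∀ j → tri system x y (ζ j) ≡ true
    contra (ζ , inj , T) = no-sunflower A (λ j → let _ , _ , _ , A∈F = tri⇒Triple (T j) in A∈F) A≢
        (⁅ x ⁆ ∪ ⁅ y ⁆) core⊆ meet
      where
      A : Fin (suc s) → Subset n
      A j = trip x y (ζ j)
      A≢ : ∀ {i j} → i ≢ j → A i ≢ A j
      A≢ {i} {j} i≢j e with ∈-trip⁻ (subst (ζ i ∈_) e (z∈trip x y (ζ i))) | tri⇒Triple (T i)
      ... | inj₁ ζ≡x | _ , x≢ζ , _ = x≢ζ (sym ζ≡x)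
      ... | inj₂ (inj₁ ζ≡y) | _ , _ , y≢ζ , _ = y≢ζ (sym ζ≡y)
      ... | inj₂ (inj₂ ζ≡ζ) | _ = i≢j (inj ζ≡ζ)
      core⊆ : ∀ j → ⁅ x ⁆ ∪ ⁅ y ⁆ ⊆ A j
      core⊆ j {v} v∈ with Subset.x∈p∪q⁻ ⁅ x ⁆ ⁅ y ⁆ v∈
      ... | inj₁ p rewrite Subset.x∈⁅y⁆⇒x≡y x p = x∈trip x y (ζ j)
      ... | inj₂ p rewrite Subset.x∈⁅y⁆⇒x≡y y p = y∈trip x y (ζ j)
      meet : ∀ {i j} → i ≢ j → ∀ {v} → v ∈ A i → v ∈ A j → v ∈ ⁅ x ⁆ ∪ ⁅ y ⁆
      meet {i} {j} i≢j p q with ∈-trip⁻ p | ∈-trip⁻ q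
      ... | inj₁ refl | _ = Subset.x∈p∪q⁺ (inj₁ (Subset.x∈⁅x⁆ _))
      ... | inj₂ (inj₁ refl) | _ = Subset.x∈p∪q⁺ (inj₂ (Subset.x∈⁅x⁆ _))
      ... | inj₂ (inj₂ _) | inj₁ refl = Subset.x∈p∪q⁺ (inj₁ (Subset.x∈⁅x⁆ _))
      ... | inj₂ (inj₂ _) | inj₂ (inj₁ refl) = Subset.x∈p∪q⁺ (inj₂ (Subset.x∈⁅x⁆ _))
      ... | inj₂ (inj₂ e) | inj₂ (inj₂ e′) = ⊥-elim (i≢j (inj (trans (sym e) e′)))

  -- More than `s` disjoint link edges, listed by their smaller ends `ζ`, would give triples that
  -- pairwise meet only in `x`.
  link-matching-bound : ∀ x (M : Mate (link system x)) → Mate.edges M ≤ s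
  link-matching-bound x M = ≮⇒≥ λ big → contra (∑-true⇒injection (suc s) (λ v → does (v Fin.<? μ v)) big)
    where
    open Mate M using () renaming (mate to μ; involutive to μ-involutive)
    contra : ¬ ∃ λ (ζ : Fin (suc s) → Fin n) → Injective _≡_ _≡_ ζ × ∀ j → does (ζ j Fin.<? μ (ζ j)) ≡ true
    contra (ζ , inj , T) = no-sunflower A (λ j → let _ , _ , _ , A∈F = edge j in A∈F) A≢ ⁅ x ⁆ core⊆ meet
      where
      lower : ∀ j → ζ j Fin.< μ (ζ j)
      lower j = does-true⁻ (ζ j Fin.<? μ (ζ j)) (T j)
      edge : ∀ j → Triple x (ζ j) (μ (ζ j))
      edge j = tri⇒Triple (Mate.matched M (ζ j) λ e → Fin.<-irrefl (sym e) (lower j))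
      A : Fin (suc s) → Subset n
      A j = trip x (ζ j) (μ (ζ j))
      -- The two edges would be the same with its ends in opposite order.
      ζ≢μ : ∀ i j → ζ i ≢ μ (ζ j)
      ζ≢μ i j e = Fin.<-asym (lower j) (subst₂ Fin._<_ e (trans (cong μ e) (μ-involutive (ζ j))) (lower i))
      core⊆ : ∀ j → ⁅ x ⁆ ⊆ A j
      core⊆ j v∈ rewrite Subset.x∈⁅y⁆⇒x≡y x v∈ = x∈trip x (ζ j) (μ (ζ j))
      meet : ∀ {i j} → i ≢ j → ∀ {v} → v ∈ A i → v ∈ A j → v ∈ ⁅ x ⁆
      meet {i} {j} i≢j p q with ∈-trip⁻ p | ∈-trip⁻ q
      ... | inj₁ refl | _ = Subset.x∈⁅x⁆ _
      ... | inj₂ _ | inj₁ refl = Subset.x∈⁅x⁆ _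
      ... | inj₂ (inj₁ e) | inj₂ (inj₁ e′) = ⊥-elim (i≢j (inj (trans (sym e) e′)))
      ... | inj₂ (inj₁ e) | inj₂ (inj₂ e′) = ⊥-elim (ζ≢μ i j (trans (sym e) e′))
      ... | inj₂ (inj₂ e) | inj₂ (inj₁ e′) = ⊥-elim (ζ≢μ j i (trans (sym e′) e))
      ... | inj₂ (inj₂ e) | inj₂ (inj₂ e′) = ⊥-elim (i≢j (inj (trans (sym (μ-involutive (ζ i)))
              (trans (cong μ (trans (sym e) e′)) (μ-involutive (ζ j))))))
      A≢ : ∀ {i j} → i ≢ j → A i ≢ A j
      A≢ {i} {j} i≢j e =
        let x≢ζ , _ = edge i
            ζ∈ = y∈trip x (ζ i) (μ (ζ i))
        in x≢ζ (sym (Subset.x∈⁅y⁆⇒x≡y x (meet i≢j ζ∈ (subst (ζ i ∈_) e ζ∈))))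

  -- Disjoint triples form a sunflower with empty core.
  no-matching : ¬ Matching system (suc s)
  no-matching M = no-sunflower A (λ j → let _ , _ , _ , A∈F = tri⇒Triple (matched M j) in A∈F) A≢ ∅
      (λ j v∈ → ⊥-elim (Subset.∉⊥ v∈)) (λ i≢j p q → ⊥-elim (disjoint i≢j p q))
    where
    A : Fin (suc s) → Subset n
    A j = trip (vertex M j 0F) (vertex M j 1F) (vertex M j 2F)
    member : ∀ {j v} → v ∈ A j → ∃ λ p → v ≡ vertex M j p
    member v∈ with ∈-trip⁻ v∈
    ... | inj₁ e = 0F , e
    ... | inj₂ (inj₁ e) = 1F , e
    ... | inj₂ (inj₂ e) = 2F , e
    disjoint : ∀ {i j} → i ≢ j → ∀ {v} → v ∈ A i → v ∈ A j → ⊥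
    disjoint i≢j p q with member p | member q
    ... | _ , e | _ , e′ = i≢j (proj₁ (injective M (trans (sym e) e′)))
    A≢ : ∀ {i j} → i ≢ j → A i ≢ A j
    A≢ {i} i≢j e = disjoint i≢j (x∈trip _ _ _) (subst (vertex M i 0F ∈_) e (x∈trip _ _ _))

  listed : List (Subset n) → Fin n → Fin n → Fin n → ℕ
  listed [] x y z = 0
  listed (e ∷ L) x y z = ⟦ does (spans? e x y z) ⟧ + listed L x y z

  listed-∑ : ∀ L → All (λ e → ∣ e ∣ ≡ 3) L →
             6 * length L ≤ ∑[ x < n ] ∑[ y < n ] ∑[ z < n ] listed L x y z
  listed-∑ [] [] = z≤n
  listed-∑ (e ∷ L) (e3 ∷ L3) = begin
    6 * suc (length L)           ≡⟨ *-suc 6 (length L) ⟩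
    6 + 6 * length L             ≤⟨ +-mono-≤ (spanned≥6 e e3) (listed-∑ L L3) ⟩
    spanned e e3 + ∑[ x < n ] ∑[ y < n ] ∑[ z < n ] listed L x y z
      ≡⟨ trans (sum-cong-≗ {n} λ x → trans (sum-cong-≗ {n} λ y → ∑-distrib-+ {n} _ _) (∑-distrib-+ {n} _ _)) (∑-distrib-+ {n} _ _) ⟨
    ∑[ x < n ] ∑[ y < n ] ∑[ z < n ] listed (e ∷ L) x y z ∎
    where open ≤-Reasoning

  -- A 3-set is determined by three distinct members, so another set of the list through `x`, `y`,
  -- `z` would equal `e`.
  listed-zero : ∀ {e L x y z} → ∣ e ∣ ≡ 3 → Spans e x y z → All (λ e → ∣ e ∣ ≡ 3) L → All (e ≢_) L →
                listed L x y z ≡ 0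
  listed-zero _ _ [] [] = refl
  listed-zero {e} {e′ ∷ L} {x} {y} {z} e3 sp (e3′ ∷ L3) (e≢e′ ∷ e∉L)
    rewrite dec-false (spans? e′ x y z) (λ sp′ → e≢e′ (trans (spans⇒≡ e e3 sp) (sym (spans⇒≡ e′ e3′ sp′))))
    = listed-zero e3 sp L3 e∉L

  listed≤tri : ∀ L → Unique L → All (λ e → ∣ e ∣ ≡ 3) L → All (_∈ᴸ F) L →
               ∀ x y z → listed L x y z ≤ ⟦ tri system x y z ⟧
  listed≤tri [] _ _ _ x y z = z≤n
  listed≤tri (e ∷ L) (e∉L AllPairs.∷ uniq) (e3 ∷ L3) (e∈F ∷ L∈F) x y z with spans? e x y z
  ... | no _ = listed≤tri L uniq L3 L∈F x y z
  ... | yes sp@(x≢y , x≢z , y≢z , _) rewrite listed-zero e3 sp L3 e∉L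
    | dec-true (triple? x y z) (x≢y , x≢z , y≢z , subst (_∈ᴸ F) (spans⇒≡ e e3 sp) e∈F) = ≤-refl

  -- Each member of `F` spans six ordered triples, and no ordered triple is spanned by two members.
  length-volume : 6 * length F ≤ volume system
  length-volume = ≤-trans (listed-∑ F uniform)
    (∑-mono λ x → ∑-mono λ y → ∑-mono λ z → listed≤tri F unique uniform (All.tabulate λ p → p) x y z)

-- The numerical bounds for s = 4, 5, 6

halve : ∀ {e c} → 2 * e ≤ 1 + 2 * c → e ≤ c
halve {e} {c} p = ≮⇒≥ λ c<e → <⇒≱ (≤-trans (≤-reflexive (sym (*-suc 2 c))) (*-monoʳ-≤ 2 c<e)) p

module _ {s κ d t N : ℕ} (4≤s : 4 ≤ s) (3s≤κ : 3 * s ≤ κ)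
  (ratio : ∀ h e → 2 * e ≤ (1 + 2 * h) * s → 2 * e ≤ (1 + 2 * h) * (2 * h) → 3 * e ≤ κ * h)
  (κs<3⟨2d+1⟩ : 2 * (κ * s) < 3 * suc (2 * d))
  (3s≤t : 3 * s ≤ t) (s+9≤t : s + 9 ≤ t) (2s+2≤t : 2 * s + 2 ≤ t)
  (2s²≤d+t+s : 2 * (s * s) ≤ d + t + s) (total≡2N : s * (3 * d + t) ≡ 2 * N) where

  length-bound : ∀ {n} (F : List (Subset n)) → IsSunflowerFree 3 (suc s) F → length F ≤ N
  length-bound F good = *-cancelˡ-≤ 6 (begin
    6 * length F                 ≤⟨ length-volume ⟩
    volume system                ≤⟨ volume-bound 4≤s 3s≤t s+9≤t 2s+2≤t 2s²≤d+t+s system codegree-bound degree no-matching ⟩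
    3 * (s * (3 * d + t))        ≡⟨ cong (3 *_) total≡2N ⟩
    3 * (2 * N)                  ≡⟨ *-assoc 3 2 N ⟨
    6 * N                        ∎)
    where
    open ≤-Reasoning
    open FamilyTriples good
    -- `size` is below `2 * d + 1`. For `s = 5` this rounds the edge bound 85 / 3 down to 28.
    degree : ∀ x → size (link system x) ≤ 2 * d
    degree x = s≤s⁻¹ (*-cancelˡ-< 3 _ _ (≤-<-trans
      (size-bound s κ 3s≤κ ratio s (link system x) (codegree-bound x) (link-matching-bound x)) κs<3⟨2d+1⟩))

ratio-bound : ∀ {κ h e c} → 2 * e ≤ c → 3 * c ≤ 2 * (κ * h) → 3 * e ≤ κ * h
ratio-bound {κ} {h} {e} {c} p q = *-cancelˡ-≤ 2 (begin
  2 * (3 * e)    ≡⟨ swap e ⟩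
  3 * (2 * e)    ≤⟨ *-monoʳ-≤ 3 p ⟩
  3 * c          ≤⟨ q ⟩
  2 * (κ * h)    ∎)
  where
  open ≤-Reasoning
  swap : ∀ e → 2 * (3 * e) ≡ 3 * (2 * e)
  swap = solve-∀

-- 15 is the value for the complete graph on five vertices, with `h = 2` and ten edges. For smaller
-- `h` the order of the class limits its degrees, from there on the degree bound 4 does.
ratio₄ : ∀ h e → 2 * e ≤ (1 + 2 * h) * 4 → 2 * e ≤ (1 + 2 * h) * (2 * h) → 3 * e ≤ 15 * h
ratio₄ 0 e _ q = ratio-bound {15} {0} {e} q (≤ᵇ⇒≤ _ _ tt)
ratio₄ 1 e _ q = ratio-bound {15} {1} {e} q (≤ᵇ⇒≤ _ _ tt)
ratio₄ (suc (suc j)) e p _ = ratio-bound {15} {2 + j} {e} p (m+n≤o⇒m≤o _ (≤-reflexive (sym (eq j))))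
  where
  eq : ∀ j → 2 * (15 * (2 + j)) ≡ 3 * ((1 + 2 * (2 + j)) * 4) + 6 * j
  eq = solve-∀

ratio₅ : ∀ h e → 2 * e ≤ (1 + 2 * h) * 5 → 2 * e ≤ (1 + 2 * h) * (2 * h) → 3 * e ≤ 17 * h
ratio₅ 0 e _ q = ratio-bound {17} {0} {e} q (≤ᵇ⇒≤ _ _ tt)
ratio₅ 1 e _ q = ratio-bound {17} {1} {e} q (≤ᵇ⇒≤ _ _ tt)
ratio₅ 2 e _ q = ratio-bound {17} {2} {e} q (≤ᵇ⇒≤ _ _ tt)
-- Seven vertices of degree at most 5 span at most 17 edges, as 35 is odd. Without this rounding 17
-- would be too small.
ratio₅ 3 e p _ = *-monoʳ-≤ 3 (halve {e} {17} p)
ratio₅ (suc (suc (suc (suc j)))) e p _ = ratio-bound {17} {4 + j} {e} p (m+n≤o⇒m≤o _ (≤-reflexive (sym (eq j))))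
  where
  eq : ∀ j → 2 * (17 * (4 + j)) ≡ 3 * ((1 + 2 * (4 + j)) * 5) + (1 + 4 * j)
  eq = solve-∀

-- 21 is the value for the complete graph on seven vertices, with `h = 3` and 21 edges.
ratio₆ : ∀ h e → 2 * e ≤ (1 + 2 * h) * 6 → 2 * e ≤ (1 + 2 * h) * (2 * h) → 3 * e ≤ 21 * h
ratio₆ 0 e _ q = ratio-bound {21} {0} {e} q (≤ᵇ⇒≤ _ _ tt)
ratio₆ 1 e _ q = ratio-bound {21} {1} {e} q (≤ᵇ⇒≤ _ _ tt)
ratio₆ 2 e _ q = ratio-bound {21} {2} {e} q (≤ᵇ⇒≤ _ _ tt)
ratio₆ (suc (suc (suc j))) e p _ = ratio-bound {21} {3 + j} {e} p (m+n≤o⇒m≤o _ (≤-reflexive (sym (eq j))))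
  where
  eq : ∀ j → 2 * (21 * (3 + j)) ≡ 3 * ((1 + 2 * (3 + j)) * 6) + 6 * j
  eq = solve-∀

bound₅ : ∀ {n} (F : List (Subset n)) → IsSunflowerFree 3 5 F → length F ≤ 146
bound₅ = length-bound {4} {15} {20} {13} {146} (≤ᵇ⇒≤ _ _ tt) (≤ᵇ⇒≤ _ _ tt) ratio₄ (≤ᵇ⇒≤ _ _ tt)
  (≤ᵇ⇒≤ _ _ tt) (≤ᵇ⇒≤ _ _ tt) (≤ᵇ⇒≤ _ _ tt) (≤ᵇ⇒≤ _ _ tt) refl

bound₆ : ∀ {n} (F : List (Subset n)) → IsSunflowerFree 3 6 F → length F ≤ 255
bound₆ = length-bound {5} {17} {28} {18} {255} (≤ᵇ⇒≤ _ _ tt) (≤ᵇ⇒≤ _ _ tt) ratio₅ (≤ᵇ⇒≤ _ _ tt)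
  (≤ᵇ⇒≤ _ _ tt) (≤ᵇ⇒≤ _ _ tt) (≤ᵇ⇒≤ _ _ tt) (≤ᵇ⇒≤ _ _ tt) refl

bound₇ : ∀ {n} (F : List (Subset n)) → IsSunflowerFree 3 7 F → length F ≤ 474
bound₇ = length-bound {6} {21} {42} {32} {474} (≤ᵇ⇒≤ _ _ tt) (≤ᵇ⇒≤ _ _ tt) ratio₆ (≤ᵇ⇒≤ _ _ tt)
  (≤ᵇ⇒≤ _ _ tt) (≤ᵇ⇒≤ _ _ tt) (≤ᵇ⇒≤ _ _ tt) (≤ᵇ⇒≤ _ _ tt) refl

-- Existence of the maximum

opaque
  anyFamily? : ∀ {n} m {P : List (Subset n) → Set} → (∀ F → Dec (P F)) → Dec (∃ λ F → P F × length F ≡ m)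
  anyFamily? zero P? = Dec.map′ (λ p → [] , p , refl) (λ { ([] , p , _) → p }) (P? [])
  anyFamily? (suc m) P? = Dec.map′
    (λ (e , F , p , eq) → e ∷ F , p , cong suc eq)
    (λ { (e ∷ F , p , eq) → e , F , p , suc-injective eq })
    (Subset.anySubset? λ e → anyFamily? m λ F → P? (e ∷ F))

-- Tuples are functions, so `P` has to respect pointwise equality for a tuple rebuilt from its
-- entries to inherit it.
anyTuple? : ∀ {n} k {P : (Fin k → Subset n) → Set} → (∀ {A B} → A ≗ B → P A → P B) →
            (∀ A → Dec (P A)) → Dec (∃ P)
anyTuple? {n} zero resp P? = Dec.map′ (λ p → empty , p) (λ (A , p) → resp (λ ()) p) (P? empty)
  where
  empty : Fin 0 → Subset n
  empty ()
anyTuple? {n} (suc k) {P} resp P? = Dec.map′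
  (λ (e , A , p) → cons e A , p)
  (λ (A , p) → A zero , A ∘ suc , resp (λ { zero → refl ; (suc i) → refl }) p)
  (Subset.anySubset? λ e → anyTuple? k
    (λ A≗B → resp λ { zero → refl ; (suc i) → A≗B i }) (λ A → P? (cons e A)))
  where
  cons : Subset n → (Fin k → Subset n) → Fin (suc k) → Subset n
  cons e A zero = e
  cons e A (suc i) = A i

isSunflower? : ∀ {n k} (A : Fin k → Subset n) → Dec (IsSunflower A)
isSunflower? A = Dec.map′
  (λ (inj , c , meets) → record { distinct = λ {i} {j} → inj i j ; core = c ; meets = meets })
  (λ S → (λ i j → IsSunflower.distinct S) , IsSunflower.core S , IsSunflower.meets S)
  (Fin.all? (λ i → Fin.all? λ j → (A i ≟ˢ A j) →-dec (i Fin.≟ j)) ×-dec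
   Subset.anySubset? λ c → Fin.all? λ i → Fin.all? λ j → ¬? (i Fin.≟ j) →-dec ((A i ∩ A j) ≟ˢ c))

isSunflower-resp : ∀ {n k} {A B : Fin k → Subset n} → A ≗ B → IsSunflower A → IsSunflower B
isSunflower-resp {A = A} {B} A≗B S = record
  { distinct = λ {i} {j} e → distinct (trans (A≗B i) (trans e (sym (A≗B j))))
  ; core = core
  ; meets = λ i j i≢j → trans (cong₂ _∩_ (sym (A≗B i)) (sym (A≗B j))) (meets i j i≢j)
  }
  where open IsSunflower S

opaque
  isSunflowerFree? : ∀ {n} w k (F : List (Subset n)) → Dec (IsSunflowerFree w k F)
  isSunflowerFree? {n} w k F = Dec.map′
    (λ (u , w , f) → record { unique = u ; uniform = w ; free = f })
    (λ S → IsSunflowerFree.unique S , IsSunflowerFree.uniform S , IsSunflowerFree.free S)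
    (unique? F ×-dec All.all? (λ e → ∣ e ∣ ≟ w) F ×-dec ¬? contains?)
    where
    open DecUnique (_≟ˢ_ {n}) using (unique?)
    open DecMembership (_≟ˢ_ {n}) using (_∈?_)
    contains? : Dec (ContainsSunflower k F)
    contains? = anyTuple? k
      (λ A≗B (A∈F , S) → (λ i → subst (_∈ᴸ F) (A≗B i) (A∈F i)) , isSunflower-resp A≗B S)
      (λ A → Fin.all? (λ i → A i ∈? F) ×-dec isSunflower? A)

-- Shrinking the ground set

module _ {n : ℕ} (x : Fin (suc n)) where

  lift : Subset n → Subset (suc n)
  lift p = Vec.insertAt p x false

  lift-injective : ∀ {p q} → lift p ≡ lift q → p ≡ q
  lift-injective {p} {q} e = trans (sym (Vec.removeAt-insertAt p x false))
    (trans (cong (λ r → Vec.removeAt r x) e) (Vec.removeAt-insertAt q x false))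

  -- A point added outside all sets changes neither sizes nor intersections, so a sunflower in `F`
  -- would lift.
  unlift-free : ∀ {w k F} → IsSunflowerFree w k (map lift F) → IsSunflowerFree w k F
  unlift-free good = record
    { unique = AllPairs.map (λ ne e → ne (cong lift e)) (AllPairs.map⁻ unique)
    ; uniform = All.map (λ {p} e → trans (sym (∣lift∣ x p)) e) (All.map⁻ uniform)
    ; free = λ (A , A∈F , S) → free (lift ∘ A , (λ i → ∈-map⁺ lift (A∈F i)) , record
        { distinct = IsSunflower.distinct S ∘ lift-injective
        ; core = lift (IsSunflower.core S)
        ; meets = λ i j i≢j → trans (lift-∩ x (A i) (A j)) (cong lift (IsSunflower.meets S i j i≢j))
        })
    }
    where
    open IsSunflowerFree good
    ∣lift∣ : ∀ {n} (x : Fin (suc n)) (p : Subset n) → ∣ Vec.insertAt p x false ∣ ≡ ∣ p ∣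
    ∣lift∣ zero p = refl
    ∣lift∣ (suc x) (true Vec.∷ p) = cong suc (∣lift∣ x p)
    ∣lift∣ (suc x) (false Vec.∷ p) = ∣lift∣ x p
    lift-∩ : ∀ {n} (x : Fin (suc n)) (p q : Subset n) →
             Vec.insertAt p x false ∩ Vec.insertAt q x false ≡ Vec.insertAt (p ∩ q) x false
    lift-∩ zero p q = refl
    lift-∩ (suc x) (a Vec.∷ p) (b Vec.∷ q) = cong (a ∧ b Vec.∷_) (lift-∩ x p q)

  lower-family : ∀ F → All (λ e → Vec.lookup e x ≡ false) F → map lift (map (λ e → Vec.removeAt e x) F) ≡ F
  lower-family [] [] = refl
  lower-family (e ∷ F) (ex ∷ Fx) = cong₂ _∷_
    (trans (cong (Vec.insertAt (Vec.removeAt e x) x) (sym ex)) (Vec.insertAt-removeAt e x))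
    (lower-family F Fx)

cover : ∀ {n} → List (Subset n) → Fin n → ℕ
cover [] v = 0
cover (e ∷ F) v = ⟦ Vec.lookup e v ⟧ + cover F v

∑-cover : ∀ {n w} (F : List (Subset n)) → All (λ e → ∣ e ∣ ≡ w) F → sum (cover F) ≡ length F * w
∑-cover {n} [] [] = ∑-zero {n} λ _ → refl
∑-cover {n} (e ∷ F) (p ∷ ps) = trans (∑-distrib-+ {n} _ _)
  (cong₂ _+_ (trans (sym (∣∣-∑ e)) p) (∑-cover F ps))

uncovered : ∀ {n} (F : List (Subset n)) v → cover F v ≡ 0 → All (λ e → Vec.lookup e v ≡ false) F
uncovered [] v _ = []
uncovered (e ∷ F) v p = zero-false (m+n≡0⇒m≡0 _ p) ∷ uncovered F v (m+n≡0⇒n≡0 ⟦ Vec.lookup e v ⟧ p)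
  where
  zero-false : ∀ {b} → ⟦ b ⟧ ≡ 0 → b ≡ false
  zero-false {false} _ = refl

-- On more than `length F * w` points, double counting finds a point that no set covers. It is
-- deleted, and this is repeated until the ground set is small enough.
compress : ∀ {w k} n (F : List (Subset n)) → IsSunflowerFree w k F →
           ∃ λ n′ → n′ ≤ length F * w × ∃ λ (F′ : List (Subset n′)) → IsSunflowerFree w k F′ × length F′ ≡ length F
compress zero F good = zero , z≤n , F , good , refl
compress {w} {k} (suc n) F good with suc n ≤? length F * w
... | yes small = suc n , small , F , good , refl
... | no big with ∑-<⇒∃ {suc n} {cover F} {λ _ → 1} (subst₂ _<_
                    (sym (∑-cover F (IsSunflowerFree.uniform good)))
                    (sym (trans (∑-const (suc n) 1) (*-identityʳ (suc n)))) (≰⇒> big))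
...   | x , lt with compress n (map (λ e → Vec.removeAt e x) F)
                 (unlift-free x (subst (IsSunflowerFree w k) (sym (lower-family x F (uncovered F x (n<1⇒n≡0 lt)))) good))
...     | n′ , n′≤ , F′ , good′ , eq = n′ , subst (λ l → n′ ≤ l * w) same n′≤ , F′ , good′ , trans eq same
  where
  same = List.length-map (λ e → Vec.removeAt e x) F

-- Descends from `N`: if no family attains the bound, it drops by one. By `compress` only finitely
-- many ground sets have to be searched.
maximum : ∀ {w k} N → (∀ {n} (F : List (Subset n)) → IsSunflowerFree w (suc k) F → length F ≤ N) →
          ∃ λ m → IsMaxSize w (suc k) m × m ≤ N
maximum {w} {k} zero bound = 0 , record { attained = 0 , [] , empty , refl ; bound = bound } , z≤n
  where
  empty : IsSunflowerFree w (suc k) []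
  -- A sunflower with at least one petal has a member, which the empty family lacks.
  empty = record { unique = AllPairs.[] ; uniform = [] ; free = λ (A , A∈F , _) → contradiction (A∈F zero) λ () }
maximum {w} {k} (suc N) bound
  -- The ground sets have from `0` to `suc N * w` points, hence one index more.
  with Fin.any? {suc (suc N * w)} (λ n → anyFamily? {toℕ n} (suc N) (isSunflowerFree? w (suc k)))
... | yes (n , F , good , eq) = suc N , record { attained = toℕ n , F , good , eq ; bound = bound } , ≤-refl
... | no none = let m , max , m≤N = maximum N smaller in m , max , ≤-trans m≤N (n≤1+n N)
  where
  smaller : ∀ {n} (F : List (Subset n)) → IsSunflowerFree w (suc k) F → length F ≤ N
  smaller {n} F good = s≤s⁻¹ (≤∧≢⇒< (bound F good) λ eq →
    let n′ , n′≤ , F′ , good′ , eq′ = compress n F good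
        n′< = s≤s (subst (λ l → n′ ≤ l * w) eq n′≤)
    in none (Fin.fromℕ< n′< , subst (λ n → ∃ λ (F : List (Subset n)) → IsSunflowerFree w (suc k) F × length F ≡ suc N)
         (sym (Fin.toℕ-fromℕ< n′<)) (F′ , good′ , trans eq′ eq)))

corollary4p3 : (∃ λ (m : ℕ) → IsMaxSize 3 5 m × m ≤ 146) ×
    (∃ λ (m : ℕ) → IsMaxSize 3 6 m × m ≤ 255) ×
    (∃ λ (m : ℕ) → IsMaxSize 3 7 m × m ≤ 474)
corollary4p3 = maximum 146 bound₅ , maximum 255 bound₆ , maximum 474 bound₇
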